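{- Any deterministic online algorithm for online MinLA that always moves to a feasible permutation with the lowest distance to $\pi_0$ is no better than $\Omega(n)$-competitive. That is, for each of the two classes of instances (line instances and clique instances) there are constants $\gamma>0$ and $n_0$ such that for every $n\ge n_0$: if a deterministic online algorithm on $n$ nodes always chooses, upon the reveal of $G_i$, a permutation $\pi_i$ that minimizes $d(\pi_0,\pi)$ among all MinLAs $\pi$ of $G_i$ (with an arbitrary tie-breaking rule), and this algorithm is $c$-competitive on the instances of the class with $n$ nodes, then $c\ge\gamma n$.
   Context: Let $V$ be a set of $n$ nodes. A permutation is a bijection $\pi:V\to\{1,\dots,n\}$. A MinLA of a graph $G=(V,E)$ is a permutation $\pi$ minimizing $\sum_{\{x,y\}\in E}|\pi(x)-\pi(y)|$ among all permutations. $d(\pi,\pi')$ is the Kendall tau distance: the minimum number of swaps of adjacent elements transforming $\pi$ into $\pi'$. An instance consists of an initial permutation $\pi_0$ and a sequence $G_0,\dots,G_k$ of graphs on $V$ where $G_0$ has no edges. In a clique instance, every $G_i$ is a disjoint union of cliques (isolated nodes are cliques of size one) and $G_{i+1}$ is obtained from $G_i$ by merging exactly two cliques into one. In a line instance, every $G_i$ is a disjoint union of paths (isolated nodes are paths with one node) and $G_{i+1}$ is obtained from $G_i$ by adding one edge between two distinct components. Feasible solution: permutations $\pi_1,\dots,\pi_k$ such that $\pi_i$ is a MinLA of $G_i$ for each $i$ ("feasible permutation" upon the reveal of $G_i$ means a MinLA of $G_i$); its cost is $\sum_{i=0}^{k-1}d(\pi_i,\pi_{i+1})$. A deterministic online algorithm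 chooses $\pi_i$ as a function of $\pi_0,G_0,\dots,G_i$ only. $\mathrm{Opt}(\sigma)$ is the minimum cost of a feasible solution of the instance $\sigma$. A deterministic algorithm is $c$-competitive if its cost on every instance $\sigma$ is at most $c\cdot\mathrm{Opt}(\sigma)$. -}

module Defs where

open import Data.Bool.Base using (Bool; false; T)
open import Data.Bool.Properties using (T?)
open import Data.Fin.Base using (Fin; zero; suc; toℕ; inject₁; inject!)
open import Data.Fin.Permutation using (Permutation′; _⟨$⟩ʳ_; _≈_; _∘ₚ_; transpose)
import Data.Fin.Properties as Fin
open import Data.Integer.Base using (+_)
open import Data.List.Base
  using (List; _∷_; _++_; concatMap; allFin; cartesianProduct; filter; map; sum; tabulate)
open import Data.List.Membership.Propositional using (_∈_)
open import Data.List.NonEmpty.Base using (List⁺; toList; _⁺++⁺_)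
open import Data.List.Relation.Binary.Permutation.Propositional using (_↭_)
open import Data.List.Relation.Unary.Any using (Any)
open import Data.Nat.Base using (ℕ; zero; suc; _≤_; ∣_-_∣)
open import Data.Product.Base using (_×_; _,_; ∃; ∃₂; ∃-syntax)
open import Data.Rational.Base as ℚ using (ℚ; _/_)
open import Data.Sum.Base using (_⊎_)
open import Function.Bundles using (_⇔_)
open import Relation.Binary.Construct.Closure.ReflexiveTransitive using (Star)
open import Relation.Binary.PropositionalEquality.Core using (_≡_; _≢_)
open import Relation.Nullary.Decidable using (_×-dec_)
open import Relation.Nullary.Negation.Core using (¬_)

infix 4 _IsMinimumOf_

_IsMinimumOf_ : ℕ → (ℕ → Set) → Set
m IsMinimumOf P = P m × (∀ k → P k → m ≤ k)

fromℕ : ℕ → ℚ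
fromℕ m = + m / 1

-- The nodes are the elements of Fin n, and π ⟨$⟩ʳ x is the position of the
-- node x. Positions are numbered 0, …, n - 1 instead of 1, …, n; only their
-- differences matter.

Perm : ℕ → Set
Perm n = Permutation′ n

AdjacentSwap : ∀ {n} → Perm n → Perm n → Set
AdjacentSwap π ρ = ∃₂ λ i j → toℕ j ≡ suc (toℕ i) × (π ∘ₚ transpose i j) ≈ ρ

data Swaps {n} : ℕ → Perm n → Perm n → Set where
  done : ∀ {π ρ} → π ≈ ρ → Swaps zero π ρ
  swap : ∀ {m π ρ τ} → AdjacentSwap π ρ → Swaps m ρ τ → Swaps (suc m) π τ

-- KendallTau π ρ d says that d(π, ρ) = d.

KendallTau : ∀ {n} → Perm n → Perm n → ℕ → Set
KendallTau π ρ d = d IsMinimumOf (λ m → Swaps m π ρ)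

record Graph (n : ℕ) : Set where
  field
    adj        : Fin n → Fin n → Bool
    adj-irrefl : ∀ x → adj x x ≡ false
    adj-sym    : ∀ x y → adj x y ≡ adj y x

open Graph public

module _ {n : ℕ} where

  Adj : Graph n → Fin n → Fin n → Set
  Adj G x y = T (adj G x y)

  Connected : Graph n → Fin n → Fin n → Set
  Connected G = Star (Adj G)

  -- Each edge {x, y} is listed once, as the pair with x < y.
  edges : Graph n → List (Fin n × Fin n)
  edges G = filter (λ (x , y) → (x Fin.<? y) ×-dec T? (adj G x y))
                   (cartesianProduct (allFin n) (allFin n))

  arrangementCost : Graph n → Perm n → ℕ
  arrangementCost G π =
    sum (map (λ (x , y) → ∣ toℕ (π ⟨$⟩ʳ x) - toℕ (π ⟨$⟩ʳ y) ∣) (edges G))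

  MinLA : Graph n → Perm n → Set
  MinLA G π = ∀ ρ → arrangementCost G π ≤ arrangementCost G ρ

  -- The parts list every node exactly once, and the edges of G are exactly
  -- the edges inside the parts, as given by Edge.
  IsDisjointUnion : (Edge : List⁺ (Fin n) → Fin n → Fin n → Set) →
                    Graph n → List (List⁺ (Fin n)) → Set
  IsDisjointUnion Edge G parts =
    concatMap toList parts ↭ allFin n ×
    (∀ x y → Adj G x y ⇔ Any (λ p → Edge p x y) parts)

  CliqueEdge : List⁺ (Fin n) → Fin n → Fin n → Set
  CliqueEdge p x y = x ≢ y × x ∈ toList p × y ∈ toList p

  Consecutive : List⁺ (Fin n) → Fin n → Fin n → Set
  Consecutive p x y = ∃₂ λ us vs → toList p ≡ us ++ x ∷ y ∷ vs

  PathEdge : List⁺ (Fin n) → Fin n → Fin n → Set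
  PathEdge p x y = Consecutive p x y ⊎ Consecutive p y x

  MergesTwoCliques : Graph n → Graph n → Set
  MergesTwoCliques G G′ = ∃[ p ] ∃[ q ] ∃[ rest ]
    IsDisjointUnion CliqueEdge G (p ∷ q ∷ rest) ×
    IsDisjointUnion CliqueEdge G′ ((p ⁺++⁺ q) ∷ rest)

  AddsEdgeBetweenComponents : Graph n → Graph n → Set
  AddsEdgeBetweenComponents G G′ = ∃[ a ] ∃[ b ]
    ¬ Connected G a b ×
    (∀ x y → Adj G′ x y ⇔ (Adj G x y ⊎ (x ≡ a × y ≡ b) ⊎ (x ≡ b × y ≡ a)))

data Class : Set where
  line clique : Class

Admissible : Class → ∀ {n} → Graph n → Set
Admissible line   G = ∃ (IsDisjointUnion PathEdge G)
Admissible clique G = ∃ (IsDisjointUnion CliqueEdge G)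

Step : Class → ∀ {n} → Graph n → Graph n → Set
Step line   = AddsEdgeBetweenComponents
Step clique = MergesTwoCliques

record Instance (K : Class) (n : ℕ) : Set where
  field
    start      : Perm n
    k          : ℕ
    graph      : Fin (suc k) → Graph n
    edgeless   : ∀ x y → ¬ Adj (graph zero) x y
    admissible : ∀ i → Admissible K (graph i)
    step       : ∀ (i : Fin k) → Step K (graph (inject₁ i)) (graph (suc i))

module _ {K : Class} {n : ℕ} (σ : Instance K n) where
  open Instance σ

  -- A solution s consists of π₁, …, π_k; the permutation π_{i+1} is s i.
  Solution : Set
  Solution = Fin k → Perm n

  Feasible : Solution → Set
  Feasible s = ∀ i → MinLA (graph (suc i)) (s i)

  trajectory : Solution → Fin (suc k) → Perm n
  trajectory s zero    = start
  trajectory s (suc i) = s i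

  -- HasCost s c says that the cost of s equals c.
  HasCost : Solution → ℕ → Set
  HasCost s c = ∃ λ (d : Fin k → ℕ) →
    (∀ i → KendallTau (trajectory s (inject₁ i)) (trajectory s (suc i)) (d i)) ×
    c ≡ sum (tabulate d)

  -- IsOpt o says that Opt(σ) = o.
  IsOpt : ℕ → Set
  IsOpt o = o IsMinimumOf (λ c → ∃ λ s → Feasible s × HasCost s c)

  -- G₀, …, G_{i+1}
  revealed : Fin k → List (Graph n)
  revealed i = tabulate (λ j → graph (inject! {i = suc (suc i)} j))

-- The arguments are π₀ and the graphs G₀, …, Gᵢ revealed so far, in order;
-- the result is πᵢ.

Algorithm : ℕ → Set
Algorithm n = Perm n → List (Graph n) → Perm n

run : ∀ {K n} → Algorithm n → (σ : Instance K n) → Solution σ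
run A σ i = A (Instance.start σ) (revealed σ i)

ClosestMinLA : ∀ {n} → Perm n → Graph n → Perm n → Set
ClosestMinLA π₀ G π =
  MinLA G π ×
  (∀ ρ → MinLA G ρ → ∀ d e → KendallTau π₀ π d → KendallTau π₀ ρ e → d ≤ e)

StaysClosestToStart : (K : Class) → ∀ {n} → Algorithm n → Set
StaysClosestToStart K {n} A = ∀ (σ : Instance K n) i →
  ClosestMinLA (Instance.start σ) (Instance.graph σ (suc i)) (run A σ i)

Competitive : (K : Class) → ∀ {n} → ℚ → Algorithm n → Set
Competitive K {n} c A = ∀ (σ : Instance K n) a o →
  HasCost σ (run A σ) a → IsOpt σ o → fromℕ a ℚ.≤ c ℚ.* fromℕ o

{-# OPTIONS --safe #-}
module Submission where

-- Let x be the node in the middle of π₀. The adversary grows one component from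
-- the other nodes around x, always an interval of π₀ with x left out. A MinLA
-- must put x on one side of the whole component, and the MinLA closest to π₀
-- puts it on the side where fewer nodes of the component lie in π₀. Since the
-- majority alternates every other step, x has to jump over the whole component
-- each time, with total cost Ω(n²). Moving x to the front once costs at most n,
-- and that arrangement stays feasible.

open import Data.Bool.Base using (Bool; true; false; if_then_else_)
open import Data.Bool.Properties using (T?; T-≡)
open import Data.Fin.Base using (Fin; zero; suc; toℕ; fromℕ<; inject₁; punchIn)
open import Data.Fin.Permutation
  using (_⟨$⟩ʳ_; _⟨$⟩ˡ_; _≈_; _∘ₚ_; transpose; id; flip; inverseˡ; insert; insert-punchIn;
         lift₀; remove; punchIn-permute)
import Data.Fin.Permutation.Components as PC
open import Data.Fin.Permutation.Transposition.List
  using (TranspositionList; eval; decompose; eval-decompose)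
open import Data.Fin.Properties as Fin using (toℕ-injective; injective⇒≤)
open import Data.Integer.Base as ℤ using (ℤ)
import Data.Integer.Properties as ℤ
open import Data.List.Base
  using (List; []; _∷_; [_]; _++_; length; lookup; filter; map; concatMap; cartesianProduct;
         allFin; tabulate)
open import Data.List.Membership.Propositional using (_∈_)
open import Data.List.Membership.Propositional.Properties
  using (∈-++⁺ˡ; ∈-++⁺ʳ; ∈-++⁻; ∈-filter⁺; ∈-filter⁻; ∈-allFin)
open import Data.List.Membership.Propositional.Properties.WithK using (unique∧set⇒bag)
open import Data.List.NonEmpty.Base as List⁺ using (List⁺; _∷_; toList; _⁺++⁺_)
import Data.List.Properties as List
open import Data.List.Relation.Binary.BagAndSetEquality using (∼bag⇒↭)
open import Data.List.Relation.Binary.Permutation.Propositional using (_↭_)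
import Data.List.Relation.Unary.All as All
open import Data.List.Relation.Unary.All using ([])
open import Data.List.Relation.Unary.AllPairs using ([]; _∷_)
open import Data.List.Relation.Unary.Any as Any using (Any; here; there)
import Data.List.Relation.Unary.Any.Properties as Any
open import Data.List.Relation.Unary.Unique.Propositional using (Unique)
import Data.List.Relation.Unary.Unique.Propositional.Properties as Unique
open import Data.Nat.Base
  using (ℕ; zero; suc; _+_; _*_; _∸_; _≤_; _<_; z≤n; s≤s; s≤s⁻¹; ∣_-_∣)
open import Data.Nat.DivMod using (_/_; _%_; _mod_; m≡m%n+[m/n]*n; m%n<n; m<n⇒m%n≡m)
open import Data.Nat.Induction using (<-rec)
import Data.Nat.ListAction as List
open import Data.Nat.ListAction.Properties using (sum-++)
open import Data.Nat.Properties
open import Data.Nat.Tactic.RingSolver using (solve-∀)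
open import Algebra.Properties.CommutativeMonoid.Sum +-0-commutativeMonoid
  using (∑-distrib-+; ∑-comm; ∑-permute)
open import Algebra.Properties.Semiring.Sum +-*-semiring
  using (sum; sum-syntax; sum-cong-≗; sum-replicate-zero; *-distribˡ-sum)
open import Data.Product.Base using (_×_; _,_; ∃; ∃-syntax; proj₁; proj₂)
open import Data.Rational.Base as ℚ using (ℚ; 0ℚ)
import Data.Rational.Properties as ℚ
open import Data.Rational.Unnormalised.Base as ℚᵘ using (mkℚᵘ)
import Data.Rational.Unnormalised.Properties as ℚᵘ
open import Data.Sum.Base as Sum using (_⊎_; inj₁; inj₂)
open import Function.Base using (_∘_)
open import Function.Bundles using (Equivalence; Injection; _⇔_; mk⇔)
open import Function.Construct.Identity using (⇔-id)
open import Function.Properties.Equivalence using () renaming (trans to ⇔-trans)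
open import Function.Properties.Inverse using (↔⇒↣)
open import Relation.Binary.Construct.Closure.ReflexiveTransitive using (ε; _◅_)
open import Relation.Binary.Definitions using (tri<; tri≈; tri>)
open import Relation.Binary.PropositionalEquality hiding ([_])
open import Relation.Nullary using (¬_; Dec; yes; no; contradiction; does)
open import Relation.Nullary.Decidable
  using (decidable-stable; _×-dec_; _⊎-dec_; ¬?; ⌊_⌋; toWitness; fromWitness; isYes≗does;
         dec-true; dec-false; does-⇔)
open import Relation.Unary using (Decidable)
open import Defs

-- Swaps and flipped pairs

-- Between two changes of the majority there is a time at which both sides hold equally many nodes.
-- There the tie-breaking rule decides, so nothing can be claimed about the position of x. Hence the
-- argument speaks only of times `4s`, with `1 + 2s` nodes on the left against `2s` on the right,
-- and `4s + 2`, with `1 + 2s` against `2 + 2s`. Only the first two of every four steps are charged.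
-- Lower bounds on distances do not need a formula for the Kendall tau distance: a swap changes the
-- order of x relative to at most one other node. Upper bounds on the distance to a closest MinLA
-- need explicit optimal arrangements, and for cliques the optimality of a contiguous block is the
-- laborious part. Distances and optimal costs are given as minima, and their existence is derived
-- only under double negation. This is enough, because the final inequality between rationals is
-- decidable.

⟨$⟩ʳ-injective : ∀ {n} (π : Perm n) {x y} → π ⟨$⟩ʳ x ≡ π ⟨$⟩ʳ y → x ≡ y
⟨$⟩ʳ-injective π = Injection.injective (↔⇒↣ π)

transpose-first : ∀ {n} (i j : Fin n) → PC.transpose i j i ≡ j
transpose-first i j with i Fin.≟ i
... | yes _  = refl
... | no i≢i = contradiction refl i≢i

transpose-second : ∀ {n} (i j : Fin n) → PC.transpose i j j ≡ i
transpose-second i j with j Fin.≟ i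
... | yes j≡i = j≡i
... | no _ with j Fin.≟ j
...   | yes _  = refl
...   | no j≢j = contradiction refl j≢j

transpose-other : ∀ {n} {i j k : Fin n} → k ≢ i → k ≢ j → PC.transpose i j k ≡ k
transpose-other {i = i} {j} {k} k≢i k≢j with k Fin.≟ i
... | yes k≡i = contradiction k≡i k≢i
... | no _ with k Fin.≟ j
...   | yes k≡j = contradiction k≡j k≢j
...   | no _    = refl

Before : ∀ {n} → Perm n → Fin n → Fin n → Set
Before π x y = toℕ (π ⟨$⟩ʳ x) < toℕ (π ⟨$⟩ʳ y)

SameOrder : ∀ {n} → Perm n → Perm n → Fin n → Fin n → Set
SameOrder π ρ x y = Before π x y ⇔ Before ρ x y

-- The asymmetric hypotheses on `q` match the choice of `z` in `swap-flips`: the position `j` is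
-- forbidden if `p` is `i`, and the position `i` otherwise. What remains never compares `i` with
-- `j`, the only pair of positions that the transposition reverses.
adjacent-order : ∀ {n} {i j : Fin n} → toℕ j ≡ suc (toℕ i) → ∀ {p q} →
  p ≢ q → (p ≡ i → q ≢ j) → (p ≢ i → q ≢ i) →
  toℕ p < toℕ q ⇔ toℕ (PC.transpose i j p) < toℕ (PC.transpose i j q)
adjacent-order {i = i} {j} j≡1+i {p} {q} p≢q f g with p Fin.≟ i
... | yes refl rewrite transpose-other {i = i} {j} (p≢q ∘ sym) (f refl) = mk⇔
    (λ i<q → ≤∧≢⇒< (subst (_≤ toℕ q) (sym j≡1+i) i<q) (f refl ∘ sym ∘ toℕ-injective))
    (λ j<q → <-trans (≤-reflexive (sym j≡1+i)) j<q)
... | no p≢i with p Fin.≟ j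
...   | yes refl rewrite transpose-other {i = i} {p} (g p≢i) (p≢q ∘ sym) = mk⇔
    (λ j<q → <-trans (≤-reflexive (sym j≡1+i)) j<q)
    (λ i<q → ≤∧≢⇒< (subst (_≤ toℕ q) (sym j≡1+i) i<q) (p≢q ∘ toℕ-injective))
...   | no p≢j with q Fin.≟ j
...     | yes refl rewrite transpose-second i q = mk⇔
    (λ p<j → ≤∧≢⇒< (s≤s⁻¹ (subst (toℕ p <_) j≡1+i p<j)) (p≢i ∘ toℕ-injective))
    (λ p<i → <-trans p<i (≤-reflexive (sym j≡1+i)))
...     | no q≢j rewrite transpose-other {i = i} {j} (g p≢i) q≢j = ⇔-id _

-- A swap that moves x exchanges it with a single node; all other nodes keep
-- their order relative to x.
swap-flips : ∀ {n} {π ρ : Perm n} (x : Fin n) → AdjacentSwap π ρ →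
  ∃[ z ] (∀ b → b ≢ x → b ≢ z → SameOrder π ρ x b)
swap-flips {π = π} {ρ} x (i , j , adj , eq) with (π ⟨$⟩ʳ x) Fin.≟ i
... | yes πx≡i = π ⟨$⟩ˡ j , λ b b≢x b≢z →
      subst₂ (λ u v → _ ⇔ toℕ u < toℕ v) (eq x) (eq b)
        (adjacent-order adj (b≢x ∘ sym ∘ ⟨$⟩ʳ-injective π)
          (λ _ πb≡j → b≢z (trans (sym (inverseˡ π)) (cong (π ⟨$⟩ˡ_) πb≡j)))
          (λ πx≢i → contradiction πx≡i πx≢i))
... | no πx≢i = π ⟨$⟩ˡ i , λ b b≢x b≢z →
      subst₂ (λ u v → _ ⇔ toℕ u < toℕ v) (eq x) (eq b)
        (adjacent-order adj (b≢x ∘ sym ∘ ⟨$⟩ʳ-injective π)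
          (λ πx≡i → contradiction πx≡i πx≢i)
          (λ _ πb≡i → b≢z (trans (sym (inverseˡ π)) (cong (π ⟨$⟩ˡ_) πb≡i))))

-- The list collects one partner of `x` per swap, which gives it length exactly `m`; a swap that
-- leaves `x` in place contributes some node too, and this does no harm.
swaps-flips : ∀ {n m} {π ρ : Perm n} (x : Fin n) → Swaps m π ρ →
  ∃[ zs ] (length zs ≡ m × (∀ b → b ≢ x → ¬ (b ∈ zs) → SameOrder π ρ x b))
swaps-flips {π = π} x (done eq) = [] , refl , λ b _ _ →
  subst₂ (λ u v → Before π x b ⇔ toℕ u < toℕ v) (eq x) (eq b) (⇔-id _)
swaps-flips {π = π} x (swap {ρ = ρ} s ss) with swap-flips {π = π} {ρ} x s | swaps-flips x ss
... | z , same | zs , refl , same′ = z ∷ zs , refl , λ b b≢x b∉ →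
  ⇔-trans (same b b≢x (b∉ ∘ here)) (same′ b b≢x (b∉ ∘ there))

-- Pigeonhole principle: a node whose order relative to `x` changes must occur in the list of
-- partners, and distinct nodes occur at distinct indices.
flips≤swaps : ∀ {n m k} {π ρ : Perm n} (x : Fin n) → Swaps m π ρ →
  (f : Fin k → Fin n) → (∀ {a b} → f a ≡ f b → a ≡ b) →
  (∀ a → f a ≢ x × ¬ SameOrder π ρ x (f a)) → k ≤ m
flips≤swaps x ss f f-injective flips with swaps-flips x ss
... | zs , refl , same = injective⇒≤ {f = Any.index ∘ f∈zs} λ {a} {b} eq →
    f-injective (trans (Any.lookup-index (f∈zs a))
      (trans (cong (lookup zs) eq) (sym (Any.lookup-index (f∈zs b)))))
  where
  open import Data.List.Membership.DecPropositional Fin._≟_ using (_∈?_)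
  f∈zs : ∀ a → f a ∈ zs
  f∈zs a = decidable-stable (f a ∈? zs) λ f∉ →
    proj₂ (flips a) (same (f a) (proj₁ (flips a)) f∉)

-- Adjacent swaps connect all permutations

swaps-respˡ : ∀ {n m} {π π′ ρ : Perm n} → π ≈ π′ → Swaps m π′ ρ → Swaps m π ρ
swaps-respˡ eq (done eq′) = done λ x → trans (eq x) (eq′ x)
swaps-respˡ eq (swap (i , j , adj , eq′) ss) =
  swap (i , j , adj , λ x → trans (cong (PC.transpose i j) (eq x)) (eq′ x)) ss

swaps-trans : ∀ {n m m′} {π ρ τ : Perm n} → Swaps m π ρ → Swaps m′ ρ τ → Swaps (m + m′) π τ
swaps-trans (done eq)   ss′ = swaps-respˡ eq ss′
swaps-trans (swap s ss) ss′ = swap s (swaps-trans ss ss′)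

-- Quantifying over the arrangement `π` to which `τ` is applied makes the property closed under
-- composition, so that transpositions are all that has to be checked.
record Generated {n} (τ : Perm n) : Set where
  constructor generated
  field route : ∀ π → ∃[ m ] Swaps m π (π ∘ₚ τ)

open Generated

generated-resp : ∀ {n} {σ τ : Perm n} → σ ≈ τ → Generated σ → Generated τ
generated-resp eq g = generated λ π →
  let m , ss = route g π in m + 0 , swaps-trans ss (done (eq ∘ (π ⟨$⟩ʳ_)))

generated-id : ∀ {n} → Generated {n} id
generated-id = generated λ π → 0 , done (λ _ → refl)

generated-∘ : ∀ {n} {σ τ : Perm n} → Generated σ → Generated τ → Generated (σ ∘ₚ τ)
generated-∘ {σ = σ} gσ gτ = generated λ π →
  let m , ss = route gσ π ; m′ , ss′ = route gτ (π ∘ₚ σ)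
  in m + (m′ + 0) , swaps-trans ss (swaps-trans ss′ (done λ _ → refl))

transpose-comm : ∀ {n} (i j : Fin n) → transpose i j ≈ transpose j i
transpose-comm i j k with k Fin.≟ i
... | yes refl = sym (transpose-second j k)
... | no k≢i with k Fin.≟ j
...   | yes k≡j = refl
...   | no k≢j with k Fin.≟ i
...     | yes k≡i = contradiction k≡i k≢i
...     | no _ = refl

transpose-self : ∀ {n} (i : Fin n) → id ≈ transpose i i
transpose-self i k with k Fin.≟ i
... | yes k≡i = k≡i
... | no k≢i with k Fin.≟ i
...   | yes k≡i = contradiction k≡i k≢i
...   | no _ = refl

transpose-conjugate : ∀ {n} {i j k : Fin n} → i ≢ j → i ≢ k → j ≢ k →
  transpose j k ∘ₚ transpose i j ∘ₚ transpose j k ≈ transpose i k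
transpose-conjugate {i = i} {j} {k} i≢j i≢k j≢k x with x Fin.≟ i
... | yes refl rewrite transpose-other {i = j} {k} i≢j i≢k
                     | transpose-first x j = transpose-first j k
... | no x≢i with x Fin.≟ k
...   | yes refl rewrite transpose-second j x | transpose-second i j = transpose-other i≢j i≢k
...   | no x≢k with x Fin.≟ j
...     | yes refl rewrite transpose-other {i = i} {x} (i≢k ∘ sym) (j≢k ∘ sym) = transpose-second x k
...     | no x≢j with x Fin.≟ k
...       | yes x≡k = contradiction x≡k x≢k
...       | no _ rewrite transpose-other {i = i} {j} x≢i x≢j = transpose-other x≢j x≢k

-- Induction on the distance of the positions: with `k` just before `j`, conjugating the shorter
-- transposition of `i` and `k` by the adjacent one of `k` and `j` gives that of `i` and `j`.
generated-transpose-< : ∀ {n} d (i j : Fin n) → toℕ j ≡ suc d + toℕ i → Generated (transpose i j)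
generated-transpose-< zero    i j eq = generated λ π →
  1 , swap {ρ = π ∘ₚ transpose i j} (i , j , eq , λ _ → refl) (done λ _ → refl)
generated-transpose-< {n} (suc d) i j eq =
  generated-resp (transpose-conjugate i≢k i≢j k≢j)
    (generated-∘ gkj (generated-∘ (generated-transpose-< d i k toℕ-k) gkj))
  where
  1+d+i<n : suc d + toℕ i < n
  1+d+i<n = <-trans (≤-reflexive (sym eq)) (Fin.toℕ<n j)
  k = fromℕ< 1+d+i<n
  toℕ-k : toℕ k ≡ suc d + toℕ i
  toℕ-k = Fin.toℕ-fromℕ< 1+d+i<n
  eq′ : toℕ j ≡ 1 + toℕ k
  eq′ = trans eq (cong suc (sym toℕ-k))
  gkj : Generated (transpose k j)
  gkj = generated-transpose-< 0 k j eq′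
  i≢j : i ≢ j
  i≢j i≡j = m≢1+n+m (toℕ i) (trans (cong toℕ i≡j) eq)
  i≢k : i ≢ k
  i≢k i≡k = m≢1+n+m (toℕ i) (trans (cong toℕ i≡k) toℕ-k)
  k≢j : k ≢ j
  k≢j k≡j = m≢1+n+m (toℕ k) {0} (trans (cong toℕ k≡j) eq′)

generated-transpose : ∀ {n} (i j : Fin n) → Generated (transpose i j)
generated-transpose i j with <-cmp (toℕ i) (toℕ j)
... | tri< i<j _ _ = generated-transpose-< _ i j
        (trans (sym (m∸n+n≡m i<j)) (+-suc _ _))
... | tri≈ _ i≡j _ rewrite toℕ-injective i≡j = generated-resp (transpose-self j) generated-id
... | tri> _ _ j<i = generated-resp (transpose-comm j i) (generated-transpose-< _ j i
        (trans (sym (m∸n+n≡m j<i)) (+-suc _ _)))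

generated-eval : ∀ {n} (ts : TranspositionList n) → Generated (eval ts)
generated-eval []             = generated-id
generated-eval ((i , j) ∷ ts) = generated-∘ (generated-transpose i j) (generated-eval ts)

-- This makes the set of swap counts nonempty, so that the Kendall tau distance exists, up to double
-- negation.
swaps-connected : ∀ {n} (π ρ : Perm n) → ∃[ m ] Swaps m π ρ
swaps-connected π ρ =
  let τ = flip π ∘ₚ ρ
      m , ss = route (generated-resp {τ = τ} (eval-decompose τ) (generated-eval (decompose τ))) π
  in m + 0 , swaps-trans ss (done {ρ = ρ} λ x → cong (ρ ⟨$⟩ʳ_) (inverseˡ π))

-- Arrangement costs

sum-mono-≤ : ∀ {n} {f g : Fin n → ℕ} → (∀ i → f i ≤ g i) → sum f ≤ sum g
sum-mono-≤ {zero}  f≤g = z≤n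
sum-mono-≤ {suc n} f≤g = +-mono-≤ (f≤g zero) (sum-mono-≤ (f≤g ∘ suc))

sum-mono-< : ∀ {n} {f g : Fin n → ℕ} → (∀ i → f i ≤ g i) → ∀ i → f i < g i → sum f < sum g
sum-mono-< f≤g zero    fi<gi = +-mono-<-≤ fi<gi (sum-mono-≤ (f≤g ∘ suc))
sum-mono-< f≤g (suc i) fi<gi = +-mono-≤-< (f≤g zero) (sum-mono-< (f≤g ∘ suc) i fi<gi)

module _ {A : Set} where

  sum-map-filter : ∀ {P : A → Set} (P? : Decidable P) (f : A → ℕ) xs →
    List.sum (map f (filter P? xs)) ≡ List.sum (map (λ x → if does (P? x) then f x else 0) xs)
  sum-map-filter P? f []       = refl
  sum-map-filter P? f (x ∷ xs) with does (P? x)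
  ... | true  = cong (f x +_) (sum-map-filter P? f xs)
  ... | false = sum-map-filter P? f xs

  sum-map-cartesianProduct : ∀ {B : Set} (f : A × B → ℕ) xs ys →
    List.sum (map f (cartesianProduct xs ys)) ≡
    List.sum (map (λ x → List.sum (map (λ y → f (x , y)) ys)) xs)
  sum-map-cartesianProduct f []       ys = refl
  sum-map-cartesianProduct f (x ∷ xs) ys = begin
    List.sum (map f (map (x ,_) ys ++ cartesianProduct xs ys))
      ≡⟨ cong List.sum (List.map-++ f (map (x ,_) ys) _) ⟩
    List.sum (map f (map (x ,_) ys) ++ map f (cartesianProduct xs ys))
      ≡⟨ sum-++ (map f (map (x ,_) ys)) _ ⟩
    List.sum (map f (map (x ,_) ys)) + List.sum (map f (cartesianProduct xs ys))
      ≡⟨ cong₂ _+_ (cong List.sum (sym (List.map-∘ ys))) (sum-map-cartesianProduct f xs ys) ⟩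
    List.sum (map (λ y → f (x , y)) ys) + _ ∎
    where open ≡-Reasoning

sum-tabulate : ∀ {n} (f : Fin n → ℕ) → List.sum (tabulate f) ≡ sum f
sum-tabulate {zero}  f = refl
sum-tabulate {suc n} f = cong (f zero +_) (sum-tabulate (f ∘ suc))

sum-map-allFin : ∀ {n} (f : Fin n → ℕ) → List.sum (map f (allFin n)) ≡ sum f
sum-map-allFin f = trans (cong List.sum (List.map-tabulate (λ i → i) f)) (sum-tabulate f)

module _ {n : ℕ} where

  dist : Perm n → Fin n → Fin n → ℕ
  dist π u v = ∣ toℕ (π ⟨$⟩ʳ u) - toℕ (π ⟨$⟩ʳ v) ∣

  -- Every edge is counted in both directions. The filtered list of pairs with x < y thus becomes a
  -- symmetric double sum, and minimizing it is the same as minimizing the cost.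
  orderedCost : Graph n → Perm n → ℕ
  orderedCost G π = ∑[ u < n ] ∑[ v < n ] (if adj G u v then dist π u v else 0)

  private
    half : Graph n → Perm n → Fin n → Fin n → ℕ
    half G π u v = if does ((u Fin.<? v) ×-dec T? (adj G u v)) then dist π u v else 0

    cost≡sum : ∀ G π → arrangementCost G π ≡ ∑[ u < n ] ∑[ v < n ] half G π u v
    cost≡sum G π = begin
      arrangementCost G π
        ≡⟨ sum-map-filter _ (λ (u , v) → dist π u v) (cartesianProduct (allFin n) (allFin n)) ⟩
      _ ≡⟨ sum-map-cartesianProduct (λ (u , v) → half G π u v) (allFin n) (allFin n) ⟩
      _ ≡⟨ cong List.sum (List.map-cong (λ u → sum-map-allFin (half G π u)) (allFin n)) ⟩
      _ ≡⟨ sum-map-allFin (λ u → sum (half G π u)) ⟩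
      _ ∎
      where open ≡-Reasoning

    halves : ∀ G π u v → half G π u v + half G π v u ≡ (if adj G u v then dist π u v else 0)
    halves G π u v rewrite adj-sym G v u with <-cmp (toℕ u) (toℕ v)
    ... | tri< u<v _ v≮u rewrite dec-true (u Fin.<? v) u<v | dec-false (v Fin.<? u) v≮u = lemma (adj G u v)
      where
      lemma : ∀ b → (if b then dist π u v else 0) + 0 ≡ (if b then dist π u v else 0)
      lemma _ = +-identityʳ _
    ... | tri≈ u≮v u≡v _ rewrite toℕ-injective u≡v | dec-false (v Fin.<? v) (<-irrefl refl) | adj-irrefl G v = refl
    ... | tri> u≮v _ v<u rewrite dec-true (v Fin.<? u) v<u | dec-false (u Fin.<? v) u≮v
      | ∣-∣-comm (toℕ (π ⟨$⟩ʳ u)) (toℕ (π ⟨$⟩ʳ v)) = refl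

  cost+cost : ∀ G π → arrangementCost G π + arrangementCost G π ≡ orderedCost G π
  cost+cost G π = begin
    arrangementCost G π + arrangementCost G π
      ≡⟨ cong₂ _+_ (cost≡sum G π) (trans (cost≡sum G π) (∑-comm (half G π))) ⟩
    (∑[ u < n ] ∑[ v < n ] half G π u v) + (∑[ u < n ] ∑[ v < n ] half G π v u)
      ≡⟨ ∑-distrib-+ (λ u → ∑[ v < n ] half G π u v) (λ u → ∑[ v < n ] half G π v u) ⟨
    ∑[ u < n ] ((∑[ v < n ] half G π u v) + (∑[ v < n ] half G π v u))
      ≡⟨ sum-cong-≗ (λ u → trans (sym (∑-distrib-+ (half G π u) (λ v → half G π v u))) (sum-cong-≗ (halves G π u))) ⟩
    orderedCost G π ∎
    where open ≡-Reasoning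

  MinLA-intro : ∀ {G π} → (∀ ρ → orderedCost G π ≤ orderedCost G ρ) → MinLA G π
  MinLA-intro {G} {π} h ρ = ≮⇒≥ λ lt → <⇒≱ (+-mono-< lt lt)
    (subst₂ _≤_ (sym (cost+cost G π)) (sym (cost+cost G ρ)) (h ρ))

  MinLA-elim : ∀ {G π} → MinLA G π → ∀ ρ → orderedCost G π ≤ orderedCost G ρ
  MinLA-elim {G} {π} h ρ = subst₂ _≤_ (cost+cost G π) (cost+cost G ρ) (+-mono-≤ (h ρ) (h ρ))

  orderedCost-mono : ∀ {G π ρ} → (∀ {u v} → Adj G u v → dist π u v ≤ dist ρ u v) →
    orderedCost G π ≤ orderedCost G ρ
  orderedCost-mono {G} h = sum-mono-≤ λ u → sum-mono-≤ λ v → term u v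
    where
    term : ∀ u v → (if adj G u v then _ else 0) ≤ (if adj G u v then _ else 0)
    term u v with adj G u v | h {u} {v}
    ... | true  | h′ = h′ _
    ... | false | _  = z≤n

punchIn-≤ : ∀ {n} (i : Fin (suc n)) a → toℕ a ≤ toℕ (punchIn i a)
punchIn-≤ zero    a       = n≤1+n _
punchIn-≤ (suc i) zero    = z≤n
punchIn-≤ (suc i) (suc a) = s≤s (punchIn-≤ i a)

punchIn-> : ∀ {n} (i : Fin (suc n)) a → toℕ i < toℕ (punchIn i a) → toℕ a < toℕ (punchIn i a)
punchIn-> zero    a       _ = ≤-refl
punchIn-> (suc i) (suc a) h = s≤s (punchIn-> i a (s≤s⁻¹ h))

-- `punchIn i` recovers the positions before the node at position `i` was deleted. Deleting an
-- isolated node therefore lengthens no edge, and by the strict version below it shortens the edges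
-- across it.
punchIn-dist-≤ : ∀ {n} (i : Fin (suc n)) a b →
  ∣ toℕ a - toℕ b ∣ ≤ ∣ toℕ (punchIn i a) - toℕ (punchIn i b) ∣
punchIn-dist-≤ zero    a       b       = ≤-refl
punchIn-dist-≤ (suc i) zero    zero    = ≤-refl
punchIn-dist-≤ (suc i) zero    (suc b) = s≤s (punchIn-≤ i b)
punchIn-dist-≤ (suc i) (suc a) zero    = s≤s (punchIn-≤ i a)
punchIn-dist-≤ (suc i) (suc a) (suc b) = punchIn-dist-≤ i a b

punchIn-dist-< : ∀ {n} (i : Fin (suc n)) a b →
  toℕ (punchIn i b) < toℕ i → toℕ i < toℕ (punchIn i a) →
  ∣ toℕ a - toℕ b ∣ < ∣ toℕ (punchIn i a) - toℕ (punchIn i b) ∣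
punchIn-dist-< (suc i) (suc a) zero    b<i i<a = s≤s (punchIn-> i a (s≤s⁻¹ i<a))
punchIn-dist-< (suc i) (suc a) (suc b) b<i i<a = punchIn-dist-< i a b (s≤s⁻¹ b<i) (s≤s⁻¹ i<a)

-- Otherwise moving the isolated node to the front would shorten the edge,
-- and would lengthen no other edge.
MinLA-isolated : ∀ {m} {G : Graph (suc m)} {ρ} → MinLA G ρ → (∀ v → adj G zero v ≡ false) →
  ∀ {u v} → Adj G (suc u) (suc v) → Before ρ zero (suc u) → Before ρ zero (suc v)
MinLA-isolated {m} {G} {ρ} min isolated {u} {v} uv x<u with <-cmp (toℕ (ρ ⟨$⟩ʳ zero)) (toℕ (ρ ⟨$⟩ʳ suc v))
... | tri< x<v _ _ = x<v
... | tri≈ _ x≡v _ with () ← ⟨$⟩ʳ-injective ρ (toℕ-injective x≡v)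
... | tri> _ _ v<x = contradiction (MinLA-elim {G = G} {ρ} min ρ′) (<⇒≱ shorter)
  where
  ρ′ : Perm (suc m)
  ρ′ = lift₀ (remove zero ρ)

  positions : ∀ a → ρ ⟨$⟩ʳ suc a ≡ punchIn (ρ ⟨$⟩ʳ zero) (remove zero ρ ⟨$⟩ʳ a)
  positions a = punchIn-permute ρ zero a

  term : Perm (suc m) → Fin (suc m) → Fin (suc m) → ℕ
  term τ a b = if adj G a b then dist τ a b else 0

  terms-≤ : ∀ a b → term ρ′ a b ≤ term ρ a b
  terms-≤ zero    b rewrite isolated b = z≤n
  terms-≤ (suc a) zero rewrite adj-sym G (suc a) zero | isolated (suc a) = z≤n
  terms-≤ (suc a) (suc b) with adj G (suc a) (suc b)
  ... | false = z≤n
  ... | true = subst₂ (λ p q → dist ρ′ (suc a) (suc b) ≤ ∣ toℕ p - toℕ q ∣)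
    (sym (positions a)) (sym (positions b)) (punchIn-dist-≤ (ρ ⟨$⟩ʳ zero) _ _)

  term-< : term ρ′ (suc u) (suc v) < term ρ (suc u) (suc v)
  term-< = subst (λ b → (if b then _ else 0) < (if b then _ else 0)) (sym (Equivalence.to T-≡ uv))
    (subst₂ (λ p q → dist ρ′ (suc u) (suc v) < ∣ toℕ p - toℕ q ∣)
    (sym (positions u)) (sym (positions v))
    (punchIn-dist-< (ρ ⟨$⟩ʳ zero) _ _
      (subst (λ p → toℕ p < _) (positions v) v<x)
      (subst (λ p → _ < toℕ p) (positions u) x<u)))

  shorter : orderedCost G ρ′ < orderedCost G ρ
  shorter = sum-mono-< (λ a → sum-mono-≤ (terms-≤ a)) (suc u)
    (sum-mono-< (terms-≤ (suc u)) (suc v) term-<)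

-- Betweenness and the cost of a clique

lt : ℕ → ℕ → ℕ
lt _       zero    = 0
lt zero    (suc _) = 1
lt (suc p) (suc q) = lt p q

apart : ℕ → ℕ → ℕ
apart p q = lt p q + lt q p

between : ℕ → ℕ → ℕ → ℕ
between p q r = lt p r * lt r q + lt q r * lt r p

lt-< : ∀ {p q} → p < q → lt p q ≡ 1
lt-< {zero}  {suc q} _   = refl
lt-< {suc p} {suc q} p<q = lt-< (s≤s⁻¹ p<q)

lt-≥ : ∀ {p q} → q ≤ p → lt p q ≡ 0
lt-≥ {_}     {zero}  _   = refl
lt-≥ {suc p} {suc q} q≤p = lt-≥ (s≤s⁻¹ q≤p)

apart-self : ∀ p → apart p p ≡ 0
apart-self p = cong₂ _+_ (lt-≥ {p} ≤-refl) (lt-≥ {p} ≤-refl)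

apart-≢ : ∀ {p q} → p ≢ q → apart p q ≡ 1
apart-≢ {p} {q} p≢q with <-cmp p q
... | tri< p<q _ _ = cong₂ _+_ (lt-< p<q) (lt-≥ (<⇒≤ p<q))
... | tri≈ _ p≡q _ = contradiction p≡q p≢q
... | tri> _ _ q<p = cong₂ _+_ (lt-≥ (<⇒≤ q<p)) (lt-< q<p)

-- `between p q r` is 1 if `r` lies strictly between `p` and `q`, in either order, and 0 otherwise.
-- Of three distinct numbers exactly one is the middle one; if two coincide, both sides vanish. The
-- recursion removes common successors until one number is zero.
between-cyclic : ∀ p q r →
  between p q r + between q r p + between r p q ≡ apart p q * apart q r * apart r p
between-cyclic zero    zero    zero    = refl
between-cyclic zero    zero    (suc r) = refl
between-cyclic zero    (suc q) zero    = refl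
between-cyclic (suc p) zero    zero    = refl
between-cyclic zero    (suc q) (suc r) = solve-lemma (lt q r) (lt r q)
  where
  solve-lemma : ∀ a b → 1 * b + a * 0 + 0 + (b * 0 + 1 * a) ≡ 1 * (a + b) * 1
  solve-lemma = solve-∀
between-cyclic (suc p) zero    (suc r) = solve-lemma (lt p r) (lt r p)
  where
  solve-lemma : ∀ a b → a * 0 + 1 * b + (1 * a + b * 0) + 0 ≡ 1 * 1 * (b + a)
  solve-lemma = solve-∀
between-cyclic (suc p) (suc q) zero    = solve-lemma (lt p q) (lt q p)
  where
  solve-lemma : ∀ a b → 0 + (b * 0 + 1 * a) + (1 * b + a * 0) ≡ (a + b) * 1 * 1
  solve-lemma = solve-∀
between-cyclic (suc p) (suc q) (suc r) = between-cyclic p q r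

sum-zero : ∀ n → ∑[ i < n ] 0 ≡ 0
sum-zero n = sum-replicate-zero n

sum-lt : ∀ {n} q → q ≤ n → ∑[ r < n ] lt (toℕ r) q ≡ q
sum-lt {n}     zero    _   = sum-zero n
sum-lt {suc n} (suc q) q≤n = cong suc (sum-lt q (s≤s⁻¹ q≤n))

-- The distance of distinct positions exceeds the number of positions strictly between them by one;
-- `apart` supplies this one, and supplies 0 if the positions agree.
∣-∣≡apart+between : ∀ {n} (p q : Fin n) →
  ∣ toℕ p - toℕ q ∣ ≡ apart (toℕ p) (toℕ q) + ∑[ r < n ] between (toℕ p) (toℕ q) (toℕ r)
∣-∣≡apart+between {suc n} zero zero = sym (sum-zero n)
∣-∣≡apart+between {suc n} zero (suc q) = cong suc (begin
  toℕ q
    ≡⟨ sum-lt (toℕ q) (<⇒≤ (Fin.toℕ<n q)) ⟨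
  ∑[ r < n ] lt (toℕ r) (toℕ q)
    ≡⟨ sum-cong-≗ {n} (λ r → simplify (lt (toℕ r) (toℕ q)) (lt (toℕ q) (toℕ r))) ⟨
  ∑[ r < n ] between 0 (suc (toℕ q)) (suc (toℕ r)) ∎)
  where
  open ≡-Reasoning
  simplify : ∀ a b → 1 * a + b * 0 ≡ a
  simplify = solve-∀
∣-∣≡apart+between {suc n} (suc p) zero = cong suc (begin
  toℕ p
    ≡⟨ sum-lt (toℕ p) (<⇒≤ (Fin.toℕ<n p)) ⟨
  ∑[ r < n ] lt (toℕ r) (toℕ p)
    ≡⟨ sum-cong-≗ {n} (λ r → simplify (lt (toℕ r) (toℕ p)) (lt (toℕ p) (toℕ r))) ⟨
  ∑[ r < n ] between (suc (toℕ p)) 0 (suc (toℕ r)) ∎)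
  where
  open ≡-Reasoning
  simplify : ∀ a b → b * 0 + 1 * a ≡ a
  simplify = solve-∀
∣-∣≡apart+between {suc n} (suc p) (suc q) = ∣-∣≡apart+between p q

module _ {n : ℕ} where

  dist≡apart+between : ∀ (ρ : Perm n) u v → dist ρ u v ≡
    apart (toℕ (ρ ⟨$⟩ʳ u)) (toℕ (ρ ⟨$⟩ʳ v)) +
    ∑[ x < n ] between (toℕ (ρ ⟨$⟩ʳ u)) (toℕ (ρ ⟨$⟩ʳ v)) (toℕ (ρ ⟨$⟩ʳ x))
  dist≡apart+between ρ u v = trans (∣-∣≡apart+between (ρ ⟨$⟩ʳ u) (ρ ⟨$⟩ʳ v))
    (cong (apart (toℕ (ρ ⟨$⟩ʳ u)) (toℕ (ρ ⟨$⟩ʳ v)) +_)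
      (∑-permute (λ r → between (toℕ (ρ ⟨$⟩ʳ u)) (toℕ (ρ ⟨$⟩ʳ v)) (toℕ r)) ρ))

  apart-permute : ∀ (π ρ : Perm n) u v →
    apart (toℕ (π ⟨$⟩ʳ u)) (toℕ (π ⟨$⟩ʳ v)) ≡ apart (toℕ (ρ ⟨$⟩ʳ u)) (toℕ (ρ ⟨$⟩ʳ v))
  apart-permute π ρ u v with u Fin.≟ v
  ... | yes refl = trans (apart-self (toℕ (π ⟨$⟩ʳ u))) (sym (apart-self (toℕ (ρ ⟨$⟩ʳ u))))
  ... | no u≢v = trans (apart-≢ (u≢v ∘ ⟨$⟩ʳ-injective π ∘ toℕ-injective))
                  (sym (apart-≢ (u≢v ∘ ⟨$⟩ʳ-injective ρ ∘ toℕ-injective)))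

  ∑³ : (Fin n → Fin n → Fin n → ℕ) → ℕ
  ∑³ f = ∑[ u < n ] ∑[ v < n ] ∑[ x < n ] f u v x

  ∑³-cong : ∀ {f g} → (∀ u v x → f u v x ≡ g u v x) → ∑³ f ≡ ∑³ g
  ∑³-cong eq = sum-cong-≗ λ u → sum-cong-≗ λ v → sum-cong-≗ (eq u v)

  ∑³-mono : ∀ {f g} → (∀ u v x → f u v x ≤ g u v x) → ∑³ f ≤ ∑³ g
  ∑³-mono h = sum-mono-≤ λ u → sum-mono-≤ λ v → sum-mono-≤ (h u v)

  ∑³-distrib-+ : ∀ f g → ∑³ (λ u v x → f u v x + g u v x) ≡ ∑³ f + ∑³ g
  ∑³-distrib-+ f g = trans
    (sum-cong-≗ λ u → trans (sum-cong-≗ λ v → ∑-distrib-+ (f u v) (g u v))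
      (∑-distrib-+ (λ v → sum (f u v)) (λ v → sum (g u v))))
    (∑-distrib-+ (λ u → ∑[ v < n ] sum (f u v)) (λ u → ∑[ v < n ] sum (g u v)))

  ∑³-rotate : ∀ f → ∑³ (λ u v x → f v x u) ≡ ∑³ f
  ∑³-rotate f = trans (∑-comm (λ u v → ∑[ x < n ] f v x u))
    (sum-cong-≗ λ v → ∑-comm (λ u x → f v x u))

  module _ (w : Fin n → ℕ) where

    weighted : Perm n → Fin n → Fin n → Fin n → ℕ
    weighted ρ u v x = w u * w v * w x *
      between (toℕ (ρ ⟨$⟩ʳ u)) (toℕ (ρ ⟨$⟩ʳ v)) (toℕ (ρ ⟨$⟩ʳ x))

    weighted-cyclic : ∀ ρ u v x →
      weighted ρ u v x + weighted ρ v x u + weighted ρ x u v ≡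
      w u * w v * w x * (apart (toℕ (ρ ⟨$⟩ʳ u)) (toℕ (ρ ⟨$⟩ʳ v)) *
        apart (toℕ (ρ ⟨$⟩ʳ v)) (toℕ (ρ ⟨$⟩ʳ x)) * apart (toℕ (ρ ⟨$⟩ʳ x)) (toℕ (ρ ⟨$⟩ʳ u)))
    weighted-cyclic ρ u v x = trans
      (factor (w u) (w v) (w x) (between p q r) (between q r p) (between r p q))
      (cong (w u * w v * w x *_) (between-cyclic p q r))
      where
      p = toℕ (ρ ⟨$⟩ʳ u)
      q = toℕ (ρ ⟨$⟩ʳ v)
      r = toℕ (ρ ⟨$⟩ʳ x)
      factor : ∀ a b c d e f → a * b * c * d + b * c * a * e + c * a * b * f ≡ a * b * c * (d + e + f)
      factor = solve-∀

    -- Renaming the summation variables cyclically does not change the sum. In the total of the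
    -- three versions each triple contributes a product of `apart` terms, and these depend only on
    -- which nodes coincide, not on `ρ`.
    weighted-thrice : ∀ ρ → ∑³ (weighted ρ) + ∑³ (weighted ρ) + ∑³ (weighted ρ) ≡
      ∑³ (λ u v x → w u * w v * w x * (apart (toℕ (ρ ⟨$⟩ʳ u)) (toℕ (ρ ⟨$⟩ʳ v)) *
        apart (toℕ (ρ ⟨$⟩ʳ v)) (toℕ (ρ ⟨$⟩ʳ x)) * apart (toℕ (ρ ⟨$⟩ʳ x)) (toℕ (ρ ⟨$⟩ʳ u))))
    weighted-thrice ρ = begin
      ∑³ f + ∑³ f + ∑³ f
        ≡⟨ cong₂ (λ a b → ∑³ f + a + b) (∑³-rotate f) (trans (∑³-rotate (λ u v x → f v x u)) (∑³-rotate f)) ⟨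
      ∑³ f + ∑³ (λ u v x → f v x u) + ∑³ (λ u v x → f x u v)
        ≡⟨ cong (_+ ∑³ (λ u v x → f x u v)) (∑³-distrib-+ f (λ u v x → f v x u)) ⟨
      ∑³ (λ u v x → f u v x + f v x u) + ∑³ (λ u v x → f x u v)
        ≡⟨ ∑³-distrib-+ (λ u v x → f u v x + f v x u) (λ u v x → f x u v) ⟨
      ∑³ (λ u v x → f u v x + f v x u + f x u v)
        ≡⟨ ∑³-cong (weighted-cyclic ρ) ⟩
      _ ∎
      where
      open ≡-Reasoning
      f = weighted ρ

    weighted-permute : ∀ π ρ → ∑³ (weighted π) ≡ ∑³ (weighted ρ)
    weighted-permute π ρ = *-cancelˡ-≡ _ _ 3 (begin
      3 * ∑³ (weighted π) ≡⟨ thrice (∑³ (weighted π)) ⟩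
      ∑³ (weighted π) + ∑³ (weighted π) + ∑³ (weighted π) ≡⟨ weighted-thrice π ⟩
      _ ≡⟨ ∑³-cong (λ u v x → cong (w u * w v * w x *_)
             (cong₂ _*_ (cong₂ _*_ (apart-permute π ρ u v) (apart-permute π ρ v x)) (apart-permute π ρ x u))) ⟩
      _ ≡⟨ weighted-thrice ρ ⟨
      ∑³ (weighted ρ) + ∑³ (weighted ρ) + ∑³ (weighted ρ) ≡⟨ thrice (∑³ (weighted ρ)) ⟨
      3 * ∑³ (weighted ρ) ∎)
      where
      open ≡-Reasoning
      thrice : ∀ a → 3 * a ≡ a + a + a
      thrice = solve-∀

    weightedDist : Perm n → ℕ
    weightedDist ρ = ∑[ u < n ] ∑[ v < n ] (w u * w v * dist ρ u v)

    pairs : Perm n → ℕ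
    pairs ρ = ∑[ u < n ] ∑[ v < n ] (w u * w v * apart (toℕ (ρ ⟨$⟩ʳ u)) (toℕ (ρ ⟨$⟩ʳ v)))

    weightedDist-split : ∀ ρ → weightedDist ρ ≡ pairs ρ +
      ∑³ (λ u v x → w u * w v * between (toℕ (ρ ⟨$⟩ʳ u)) (toℕ (ρ ⟨$⟩ʳ v)) (toℕ (ρ ⟨$⟩ʳ x)))
    weightedDist-split ρ = trans
      (sum-cong-≗ λ u → trans
        (sum-cong-≗ λ v → begin
          w u * w v * dist ρ u v
            ≡⟨ cong (w u * w v *_) (dist≡apart+between ρ u v) ⟩
          w u * w v * (a u v + ∑[ x < n ] b u v x)
            ≡⟨ *-distribˡ-+ (w u * w v) (a u v) _ ⟩
          w u * w v * a u v + w u * w v * (∑[ x < n ] b u v x)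
            ≡⟨ cong (w u * w v * a u v +_) (*-distribˡ-sum (w u * w v) (b u v)) ⟩
          w u * w v * a u v + (∑[ x < n ] (w u * w v * b u v x)) ∎)
        (∑-distrib-+ (λ v → w u * w v * a u v) (λ v → ∑[ x < n ] (w u * w v * b u v x))))
      (∑-distrib-+ (λ u → ∑[ v < n ] (w u * w v * a u v)) (λ u → ∑[ v < n ] ∑[ x < n ] (w u * w v * b u v x)))
      where
      open ≡-Reasoning
      a : Fin n → Fin n → ℕ
      a u v = apart (toℕ (ρ ⟨$⟩ʳ u)) (toℕ (ρ ⟨$⟩ʳ v))
      b : Fin n → Fin n → Fin n → ℕ
      b u v x = between (toℕ (ρ ⟨$⟩ʳ u)) (toℕ (ρ ⟨$⟩ʳ v)) (toℕ (ρ ⟨$⟩ʳ x))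

    -- Up to the number of pairs, the cost of a clique counts the nodes between the
    -- ends of its edges. Those in the clique are as many in every arrangement,
    -- because exactly one of three distinct nodes lies between the other two.
    weightedDist-minimal : (∀ x → w x ≤ 1) → ∀ π →
      (∀ u v x → w u * w v * between (toℕ (π ⟨$⟩ʳ u)) (toℕ (π ⟨$⟩ʳ v)) (toℕ (π ⟨$⟩ʳ x)) ≡ weighted π u v x) →
      ∀ ρ → weightedDist π ≤ weightedDist ρ
    weightedDist-minimal w≤1 π contiguous ρ = begin
      weightedDist π ≡⟨ weightedDist-split π ⟩
      pairs π + _ ≡⟨ cong₂ _+_ (sum-cong-≗ λ u → sum-cong-≗ λ v → cong (w u * w v *_) (apart-permute π ρ u v))
                         (trans (∑³-cong contiguous) (weighted-permute π ρ)) ⟩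
      pairs ρ + ∑³ (weighted ρ) ≤⟨ +-monoʳ-≤ (pairs ρ) (∑³-mono λ u v x →
          *-monoˡ-≤ (between (toℕ (ρ ⟨$⟩ʳ u)) (toℕ (ρ ⟨$⟩ʳ v)) (toℕ (ρ ⟨$⟩ʳ x)))
            (≤-trans (*-monoʳ-≤ (w u * w v) (w≤1 x)) (≤-reflexive (*-identityʳ (w u * w v))))) ⟩
      pairs ρ + _ ≡⟨ weightedDist-split ρ ⟨
      weightedDist ρ ∎
      where open ≤-Reasoning

-- Graphs on an interval of nodes

-- Both classes of instances use the same intervals of labels; they differ only in whether an
-- interval carries a path in label order or a complete graph.
Close : Class → ∀ {n} → Fin n → Fin n → Set
Close line   x y = suc (toℕ x) ≡ toℕ y ⊎ suc (toℕ y) ≡ toℕ x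
Close clique x y = x ≢ y

close? : ∀ K {n} (x y : Fin n) → Dec (Close K x y)
close? line   x y = (suc (toℕ x) ≟ toℕ y) ⊎-dec (suc (toℕ y) ≟ toℕ x)
close? clique x y = ¬? (x Fin.≟ y)

close-irrefl : ∀ K {n} (x : Fin n) → ¬ Close K x x
close-irrefl line   x (inj₁ eq) = 1+n≢n eq
close-irrefl line   x (inj₂ eq) = 1+n≢n eq
close-irrefl clique x x≢x       = x≢x refl

close-sym : ∀ K {n} {x y : Fin n} → Close K x y → Close K y x
close-sym line   (inj₁ eq) = inj₂ eq
close-sym line   (inj₂ eq) = inj₁ eq
close-sym clique x≢y       = x≢y ∘ sym

close-suc : ∀ K {n} {x y : Fin n} → suc (toℕ x) ≡ toℕ y → Close K x y
close-suc line   eq      = inj₁ eq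
close-suc clique eq refl = 1+n≢n eq

Inside : ∀ {n} → ℕ → ℕ → Fin n → Set
Inside lo hi x = lo ≤ toℕ x × toℕ x < hi

inside? : ∀ {n} lo hi (x : Fin n) → Dec (Inside lo hi x)
inside? lo hi x = (lo ≤? toℕ x) ×-dec (toℕ x <? hi)

IntervalEdge : Class → ∀ {n} → ℕ → ℕ → Fin n → Fin n → Set
IntervalEdge K lo hi x y = Close K x y × Inside lo hi x × Inside lo hi y

intervalEdge? : ∀ K {n} lo hi (x y : Fin n) → Dec (IntervalEdge K lo hi x y)
intervalEdge? K lo hi x y = close? K x y ×-dec (inside? lo hi x ×-dec inside? lo hi y)

intervalEdge-sym : ∀ K {n} {lo hi} {x y : Fin n} → IntervalEdge K lo hi x y → IntervalEdge K lo hi y x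
intervalEdge-sym K (close , x∈ , y∈) = close-sym K close , y∈ , x∈

module _ {n : ℕ} where

  open import Data.List.Membership.DecPropositional (Fin._≟_ {n}) using (_∈?_)

  interval : Class → ℕ → ℕ → Graph n
  interval K lo hi = record
    { adj        = λ x y → ⌊ intervalEdge? K lo hi x y ⌋
    ; adj-irrefl = λ x → trans (isYes≗does (intervalEdge? K lo hi x x))
                     (dec-false (intervalEdge? K lo hi x x) (close-irrefl K x ∘ proj₁))
    ; adj-sym    = λ x y → trans (isYes≗does (intervalEdge? K lo hi x y)) (trans
                     (does-⇔ (mk⇔ (intervalEdge-sym K) (intervalEdge-sym K))
                        (intervalEdge? K lo hi x y) (intervalEdge? K lo hi y x))
                     (sym (isYes≗does (intervalEdge? K lo hi y x))))
    }

  interval-adj : ∀ K lo hi x y → Adj (interval K lo hi) x y ⇔ IntervalEdge K lo hi x y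
  interval-adj K lo hi x y = mk⇔ (toWitness {a? = intervalEdge? K lo hi x y}) fromWitness

  interval-outside : ∀ K {lo hi x} → ¬ Inside lo hi x → ∀ y → adj (interval K lo hi) x y ≡ false
  interval-outside K {lo} {hi} {x} x∉ y = trans (isYes≗does (intervalEdge? K lo hi x y))
    (dec-false (intervalEdge? K lo hi x y) (x∉ ∘ proj₁ ∘ proj₂))

  -- The two shapes of an interval in label order: node 0 stands to the left of it, so that position
  -- and label agree, or to the right of it, so that positions are one less than labels.
  Shifted : Perm n → ℕ → ℕ → Set
  Shifted π lo hi = (∀ x → Inside lo hi x → toℕ (π ⟨$⟩ʳ x) ≡ toℕ x) ⊎
                    (∀ x → Inside lo hi x → suc (toℕ (π ⟨$⟩ʳ x)) ≡ toℕ x)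

  shifted-dist : ∀ {π lo hi} → Shifted π lo hi → ∀ {x y} → Inside lo hi x → Inside lo hi y →
    dist π x y ≡ ∣ toℕ x - toℕ y ∣
  shifted-dist (inj₁ h) x∈ y∈ = cong₂ ∣_-_∣ (h _ x∈) (h _ y∈)
  shifted-dist (inj₂ h) x∈ y∈ = cong₂ ∣_-_∣ (h _ x∈) (h _ y∈)

  -- The positions of the interval form a contiguous block. The position of `x` is therefore that of
  -- some member `y` of the interval, and injectivity of `π` identifies `x` with `y`.
  shifted-between : ∀ {π lo hi} → Shifted π lo hi → ∀ {u v x} → Inside lo hi u → Inside lo hi v →
    Before π u x → Before π x v → Inside lo hi x
  shifted-between {π} {lo} {hi} (inj₁ h) {u} {v} {x} u∈ v∈ u<x x<v = subst (Inside lo hi) y≡x y∈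
    where
    x<v′ : toℕ (π ⟨$⟩ʳ x) < toℕ v
    x<v′ = subst (_ <_) (h v v∈) x<v
    y = π ⟨$⟩ʳ x
    y∈ : Inside lo hi y
    y∈ = ≤-trans (proj₁ u∈) (<⇒≤ (subst (_< _) (h u u∈) u<x)) , <-trans x<v′ (proj₂ v∈)
    y≡x : y ≡ x
    y≡x = ⟨$⟩ʳ-injective π (toℕ-injective (h y y∈))
  shifted-between {π} {lo} {hi} (inj₂ h) {u} {v} {x} u∈ v∈ u<x x<v = subst (Inside lo hi) y≡x y∈
    where
    x<v′ : suc (toℕ (π ⟨$⟩ʳ x)) < toℕ v
    x<v′ = subst (_ <_) (h v v∈) (s≤s x<v)
    y = fromℕ< (<-trans x<v′ (Fin.toℕ<n v))
    toℕ-y : toℕ y ≡ suc (toℕ (π ⟨$⟩ʳ x))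
    toℕ-y = Fin.toℕ-fromℕ< _
    y∈ : Inside lo hi y
    y∈ = subst (λ t → lo ≤ t × t < hi) (sym toℕ-y)
      (≤-trans (proj₁ u∈) (subst (_≤ _) (h u u∈) (m≤n⇒m≤1+n u<x)) , <-trans x<v′ (proj₂ v∈))
    y≡x : y ≡ x
    y≡x = ⟨$⟩ʳ-injective π (toℕ-injective (suc-injective (trans (h y y∈) toℕ-y)))

  indicator : ℕ → ℕ → Fin n → ℕ
  indicator lo hi x = if does (inside? lo hi x) then 1 else 0

  -- The product of indicators also counts the diagonal, where the graph has no edge, but there the
  -- distance is zero.
  cliqueCost : ∀ lo hi (π : Perm n) →
    orderedCost (interval clique lo hi) π ≡ weightedDist (indicator lo hi) π
  cliqueCost lo hi π = sum-cong-≗ λ u → sum-cong-≗ λ v → term u v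
    where
    χ : Bool → ℕ
    χ a = if a then 1 else 0
    term : ∀ u v → (if adj (interval clique lo hi) u v then dist π u v else 0) ≡
      indicator lo hi u * indicator lo hi v * dist π u v
    term u v rewrite isYes≗does (intervalEdge? clique lo hi u v)
      with u Fin.≟ v | does (inside? lo hi u) | does (inside? lo hi v)
    ... | yes refl | a     | b     = sym (trans (cong (χ a * χ b *_) (∣n-n∣≡0 (toℕ (π ⟨$⟩ʳ u)))) (*-zeroʳ (χ a * χ b)))
    ... | no _     | true  | true  = sym (+-identityʳ _)
    ... | no _     | true  | false = refl
    ... | no _     | false | b     = refl

  between-≡0 : ∀ p q r → ¬ (p < r × r < q) → ¬ (q < r × r < p) → between p q r ≡ 0
  between-≡0 p q r h h′ = cong₂ _+_ (product p q h) (product q p h′)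
    where
    product : ∀ a b → ¬ (a < r × r < b) → lt a r * lt r b ≡ 0
    product a b h with a <? r | r <? b
    ... | no a≮r  | _       rewrite lt-≥ (≮⇒≥ a≮r) = refl
    ... | yes _   | no r≮b  rewrite lt-≥ (≮⇒≥ r≮b) = *-zeroʳ (lt a r)
    ... | yes a<r | yes r<b = contradiction (a<r , r<b) h

  -- For a path, every edge has length 1, the least possible for distinct nodes. For a clique, no
  -- outside node lies between two members, which is the equality case required by
  -- `weightedDist-minimal`.
  shifted-MinLA : ∀ K {π lo hi} → Shifted π lo hi → MinLA (interval K lo hi) π
  shifted-MinLA line {π} {lo} {hi} shifted = MinLA-intro {G = interval line lo hi} {π} λ ρ →
    orderedCost-mono {G = interval line lo hi} {π} {ρ} λ {u} {v} uv →
      let close , u∈ , v∈ = Equivalence.to (interval-adj line lo hi u v) uv in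
      subst (_≤ dist ρ u v) (sym (trans (shifted-dist {π} shifted u∈ v∈) (unit close)))
        (n≢0⇒n>0 λ eq → close-irrefl line v (subst (λ z → Close line z v) (⟨$⟩ʳ-injective ρ (toℕ-injective (∣m-n∣≡0⇒m≡n eq))) close))
    where
    unit : ∀ {u v : Fin n} → Close line u v → ∣ toℕ u - toℕ v ∣ ≡ 1
    unit {u} {v} (inj₁ eq) rewrite sym eq = trans (m≤n⇒∣m-n∣≡n∸m (n≤1+n (toℕ u))) (m+n∸n≡m 1 (toℕ u))
    unit {u} {v} (inj₂ eq) rewrite sym eq = trans (m≤n⇒∣n-m∣≡n∸m (n≤1+n (toℕ v))) (m+n∸n≡m 1 (toℕ v))
  shifted-MinLA clique {π} {lo} {hi} shifted = MinLA-intro {G = interval clique lo hi} {π} λ ρ →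
    subst₂ _≤_ (sym (cliqueCost lo hi π)) (sym (cliqueCost lo hi ρ))
      (weightedDist-minimal (indicator lo hi) indicator≤1 π contiguous ρ)
    where
    indicator≤1 : ∀ x → indicator lo hi x ≤ 1
    indicator≤1 x with does (inside? lo hi x)
    ... | true  = ≤-refl
    ... | false = z≤n
    χ : ∀ {x : Fin n} → Dec (Inside lo hi x) → ℕ
    χ x? = if does x? then 1 else 0
    b : Fin n → Fin n → Fin n → ℕ
    b u v x = between (toℕ (π ⟨$⟩ʳ u)) (toℕ (π ⟨$⟩ʳ v)) (toℕ (π ⟨$⟩ʳ x))
    outside : ∀ {u v x} → Inside lo hi u → Inside lo hi v → ¬ Inside lo hi x → b u v x ≡ 0
    outside u∈ v∈ x∉ = between-≡0 _ _ _
      (λ (u<x , x<v) → x∉ (shifted-between {π} shifted u∈ v∈ u<x x<v))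
      (λ (v<x , x<u) → x∉ (shifted-between {π} shifted v∈ u∈ v<x x<u))
    split : ∀ {u v x} (u? : Dec (Inside lo hi u)) (v? : Dec (Inside lo hi v)) (x? : Dec (Inside lo hi x)) →
      χ u? * χ v? * b u v x ≡ χ u? * χ v? * χ x? * b u v x
    split {u} {v} {x} u? v? (yes _) = cong (_* b u v x) (sym (*-identityʳ (χ u? * χ v?)))
    split (no _)   _        (no _)  = refl
    split (yes _)  (no _)   (no _)  = refl
    split (yes u∈) (yes v∈) (no x∉) = trans (+-identityʳ _) (outside u∈ v∈ x∉)
    contiguous : ∀ u v x →
      indicator lo hi u * indicator lo hi v * b u v x ≡ weighted (indicator lo hi) π u v x
    contiguous u v x = split (inside? lo hi u) (inside? lo hi v) (inside? lo hi x)

  -- Both lists are free of duplicates and contain every node, and duplicate-free lists with the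
  -- same members are permutations of each other.
  complete : ∀ {p : List (Fin n)} → Unique p →
    p ++ filter (λ x → ¬? (x ∈? p)) (allFin n) ↭ allFin n
  complete {p} unique = ∼bag⇒↭ (unique∧set⇒bag
    (Unique.++⁺ unique (Unique.filter⁺ _ (Unique.allFin⁺ n)) λ (x∈p , x∈rest) →
      proj₂ (∈-filter⁻ (λ x → ¬? (x ∈? p)) {xs = allFin n} x∈rest) x∈p)
    (Unique.allFin⁺ n)
    (λ {x} → mk⇔ (λ _ → ∈-allFin x) λ _ → member x))
    where
    member : ∀ x → x ∈ p ++ filter (λ x → ¬? (x ∈? p)) (allFin n)
    member x with x ∈? p
    ... | yes x∈p = ∈-++⁺ˡ x∈p
    ... | no x∉p  = ∈-++⁺ʳ p (∈-filter⁺ _ (∈-allFin x) x∉p)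

  singletons : List (Fin n) → List (List⁺ (Fin n))
  singletons = map List⁺.[_]

  concatMap-singletons : ∀ r → concatMap toList (singletons r) ≡ r
  concatMap-singletons []      = refl
  concatMap-singletons (x ∷ r) = cong (x ∷_) (concatMap-singletons r)

  ¬Any-singletons : ∀ {Q : List⁺ (Fin n) → Set} → (∀ z → ¬ Q List⁺.[ z ]) → ∀ r → ¬ Any Q (singletons r)
  ¬Any-singletons h (x ∷ r) (here q)  = h x q
  ¬Any-singletons h (x ∷ r) (there a) = ¬Any-singletons h r a

  ¬cliqueEdge-singleton : ∀ {x y : Fin n} z → ¬ CliqueEdge List⁺.[ z ] x y
  ¬cliqueEdge-singleton z (x≢y , here x≡z , here y≡z) = x≢y (trans x≡z (sym y≡z))

  ¬pathEdge-singleton : ∀ {x y : Fin n} z → ¬ PathEdge List⁺.[ z ] x y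
  ¬pathEdge-singleton z (inj₁ (us , vs , eq)) = short us eq
    where
    short : ∀ {x y} us {vs} → ¬ z ∷ [] ≡ us ++ x ∷ y ∷ vs
    short (_ ∷ []) ()
    short (_ ∷ _ ∷ _) ()
  ¬pathEdge-singleton z (inj₂ c) = ¬pathEdge-singleton z (inj₁ c)

  remaining : List (Fin n) → List (Fin n)
  remaining p = filter (λ x → ¬? (x ∈? p)) (allFin n)

  line-admissible : ∀ {lo hi} (p : List⁺ (Fin n)) → Unique (toList p) →
    (∀ x y → PathEdge p x y ⇔ IntervalEdge line lo hi x y) →
    Admissible line (interval line lo hi)
  line-admissible {lo} {hi} p unique edges = p ∷ singletons (remaining (toList p)) ,
    subst (λ r → toList p ++ r ↭ allFin n) (sym (concatMap-singletons _)) (complete unique) ,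
    λ x y → ⇔-trans (interval-adj line lo hi x y) (mk⇔
      (here ∘ Equivalence.from (edges x y))
      λ { (here e) → Equivalence.to (edges x y) e
        ; (there a) → contradiction a (¬Any-singletons ¬pathEdge-singleton (remaining (toList p))) })

  clique-union : ∀ {lo hi} (p : List⁺ (Fin n)) r → toList p ++ r ↭ allFin n →
    (∀ x → x ∈ toList p ⇔ Inside lo hi x) →
    IsDisjointUnion CliqueEdge (interval clique lo hi) (p ∷ singletons r)
  clique-union {lo} {hi} p r perm members =
    subst (λ r → toList p ++ r ↭ allFin n) (sym (concatMap-singletons _)) perm ,
    λ x y → ⇔-trans (interval-adj clique lo hi x y) (mk⇔
      (λ (x≢y , x∈ , y∈) → here (x≢y , Equivalence.from (members x) x∈ , Equivalence.from (members y) y∈))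
      λ { (here (x≢y , x∈ , y∈)) → x≢y , Equivalence.to (members x) x∈ , Equivalence.to (members y) y∈
        ; (there a) → contradiction a (¬Any-singletons ¬cliqueEdge-singleton r) })

  clique-admissible : ∀ {lo hi} (p : List⁺ (Fin n)) → Unique (toList p) →
    (∀ x → x ∈ toList p ⇔ Inside lo hi x) → Admissible clique (interval clique lo hi)
  clique-admissible p unique members = p ∷ singletons (remaining (toList p)) ,
    clique-union p (remaining (toList p)) (complete unique) members

  clique-merge : ∀ {lo hi lo′ hi′} (p : List⁺ (Fin n)) ν → Unique (toList p ++ [ ν ]) →
    (∀ x → x ∈ toList p ⇔ Inside lo hi x) → (∀ x → x ∈ toList p ++ [ ν ] ⇔ Inside lo′ hi′ x) →
    MergesTwoCliques (interval clique lo hi) (interval clique lo′ hi′)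
  clique-merge p ν unique members members′ = p , List⁺.[ ν ] , singletons r ,
    clique-union p (ν ∷ r) (subst (_↭ allFin n) (List.++-assoc (toList p) [ ν ] r) (complete unique)) members ,
    clique-union (p ⁺++⁺ List⁺.[ ν ]) r (complete unique) members′
    where
    -- `ν` is left out of the rest in both decompositions, because a merge must keep all other
    -- cliques literally the same.
    r = remaining (toList p ++ [ ν ])

  inside-connected : ∀ {K lo hi x y} → Inside lo hi x → Connected (interval K lo hi) x y → Inside lo hi y
  inside-connected x∈ ε = x∈
  inside-connected {K} {lo} {hi} x∈ (e ◅ es) =
    inside-connected {K} (proj₂ (proj₂ (Equivalence.to (interval-adj K lo hi _ _) e))) es

  line-extend : ∀ {lo hi lo′ hi′ a ν} → Inside lo hi a → ¬ Inside lo hi ν →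
    (∀ x y → IntervalEdge line lo′ hi′ x y ⇔
      (IntervalEdge line lo hi x y ⊎ (x ≡ a × y ≡ ν) ⊎ (x ≡ ν × y ≡ a))) →
    AddsEdgeBetweenComponents (interval line lo hi) (interval line lo′ hi′)
  line-extend {lo} {hi} {lo′} {hi′} {a} {ν} a∈ ν∉ edges = a , ν , ν∉ ∘ inside-connected {line} a∈ , λ x y → mk⇔
    (λ e → Sum.map₁ (Equivalence.from (interval-adj line lo hi x y))
      (Equivalence.to (edges x y) (Equivalence.to (interval-adj line lo′ hi′ x y) e)))
    (λ e → Equivalence.from (interval-adj line lo′ hi′ x y) (Equivalence.from (edges x y)
      (Sum.map₁ (Equivalence.to (interval-adj line lo hi x y)) e)))

-- Intervals as lists of nodes, and growing an interval by one node

module _ {m : ℕ} where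

  -- Reduction modulo the number of nodes makes this total, so that nodes can be named by numbers
  -- and the bound is needed only where the label is computed.
  node : ℕ → Fin (suc m)
  node t = t mod suc m

  toℕ-node : ∀ {t} → t < suc m → toℕ (node t) ≡ t
  toℕ-node {t} t<n = trans (Fin.toℕ-fromℕ< (m%n<n t (suc m))) (m<n⇒m%n≡m t<n)

  segment : ℕ → ℕ → List (Fin (suc m))
  segment lo zero    = []
  segment lo (suc l) = node lo ∷ segment (suc lo) l

  segment-inside : ∀ {lo hi} l → lo + l ≡ hi → hi ≤ suc m → ∀ {x} → x ∈ segment lo l → Inside lo hi x
  segment-inside {lo} {hi} (suc l) eq hi≤n {x} (here refl) =
    subst (λ t → lo ≤ t × t < hi) (sym (toℕ-node (<-≤-trans lo<hi hi≤n))) (≤-refl , lo<hi)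
    where
    lo<hi : lo < hi
    lo<hi = subst (lo <_) eq (m<m+n lo (s≤s z≤n))
  segment-inside {lo} (suc l) eq hi≤n (there x∈) =
    let 1+lo≤x , x<hi = segment-inside l (trans (sym (+-suc lo l)) eq) hi≤n x∈ in
    <⇒≤ 1+lo≤x , x<hi

  inside-segment : ∀ {lo hi} l → lo + l ≡ hi → hi ≤ suc m → ∀ {x} → Inside lo hi x → x ∈ segment lo l
  inside-segment {lo} zero eq hi≤n (lo≤x , x<hi) =
    contradiction (≤-<-trans lo≤x (subst (_ <_) (trans (sym eq) (+-identityʳ lo)) x<hi)) (<-irrefl refl)
  inside-segment {lo} {hi} (suc l) eq hi≤n {x} (lo≤x , x<hi) with lo ≟ toℕ x
  ... | yes lo≡x = here (toℕ-injective (trans (sym lo≡x) (sym (toℕ-node (subst (_< suc m) (sym lo≡x) (<-≤-trans x<hi hi≤n))))))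
  ... | no lo≢x = there (inside-segment l (trans (sym (+-suc lo l)) eq) hi≤n (≤∧≢⇒< lo≤x lo≢x , x<hi))

  segment-unique : ∀ {lo hi} l → lo + l ≡ hi → hi ≤ suc m → Unique (segment lo l)
  segment-unique zero eq hi≤n = []
  segment-unique {lo} {hi} (suc l) eq hi≤n =
    All.tabulate (λ {x} x∈ node≡x → <-irrefl
      (trans (sym (toℕ-node (<-≤-trans (subst (lo <_) eq (m<m+n lo (s≤s z≤n))) hi≤n))) (cong toℕ node≡x))
      (proj₁ (segment-inside l eq′ hi≤n x∈)))
    ∷ segment-unique l eq′ hi≤n
    where
    eq′ : suc lo + l ≡ hi
    eq′ = trans (sym (+-suc lo l)) eq

  segment-consecutive : ∀ {lo hi} l → lo + l ≡ hi → hi ≤ suc m → ∀ us {x y vs} →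
    segment lo l ≡ us ++ x ∷ y ∷ vs → suc (toℕ x) ≡ toℕ y
  segment-consecutive {lo} {hi} (suc (suc l)) eq hi≤n [] refl =
    trans (cong suc (toℕ-node (<-trans ≤-refl 1+lo<n))) (sym (toℕ-node 1+lo<n))
    where
    1+lo<n : suc lo < suc m
    1+lo<n = <-≤-trans (subst (suc lo <_) (trans (sym (+-suc lo (suc l))) eq) (m<m+n (suc lo) (s≤s z≤n))) hi≤n
  segment-consecutive {lo} (suc l) eq hi≤n (u ∷ us) eq′ =
    segment-consecutive l (trans (sym (+-suc lo l)) eq) hi≤n us (proj₂ (List.∷-injective eq′))

  consecutive-segment : ∀ {lo hi} l → lo + l ≡ hi → hi ≤ suc m → ∀ {x y} → suc (toℕ x) ≡ toℕ y →
    Inside lo hi x → Inside lo hi y → ∃[ us ] ∃[ vs ] segment lo l ≡ us ++ x ∷ y ∷ vs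
  consecutive-segment {lo} {hi} l eq hi≤n {x} {y} 1+x≡y x∈ y∈ = go l eq x∈
    where
    go : ∀ {lo} l → lo + l ≡ hi → Inside lo hi x → ∃[ us ] ∃[ vs ] segment lo l ≡ us ++ x ∷ y ∷ vs
    go {lo} l eq (lo≤x , x<hi) with lo ≟ toℕ x
    go {lo} zero eq (lo≤x , x<hi) | _ =
      contradiction (≤-<-trans lo≤x (subst (_ <_) (trans (sym eq) (+-identityʳ lo)) x<hi)) (<-irrefl refl)
    go {lo} (suc l) eq (lo≤x , x<hi) | no lo≢x =
      let us , vs , eq′ = go l (trans (sym (+-suc lo l)) eq) (≤∧≢⇒< lo≤x lo≢x , x<hi) in
      node lo ∷ us , vs , cong (node lo ∷_) eq′
    go {lo} (suc zero) eq (lo≤x , x<hi) | yes lo≡x =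
      contradiction (proj₂ y∈) (<-irrefl (trans (sym 1+x≡y) (trans (cong suc (sym lo≡x)) (trans (+-comm 1 lo) eq))))
    go {lo} (suc (suc l)) eq (lo≤x , x<hi) | yes lo≡x = [] , segment (suc (suc lo)) l ,
      cong₂ (λ a b → a ∷ b ∷ segment (suc (suc lo)) l)
        (is lo≡x) (is (trans (cong suc lo≡x) 1+x≡y))
      where
      is : ∀ {t z} → t ≡ toℕ z → node t ≡ z
      is {z = z} refl = toℕ-injective (toℕ-node (Fin.toℕ<n z))

  segment-length : ∀ {lo hi} → lo < hi → ∃[ l ] lo + suc l ≡ hi
  segment-length {lo} lo<hi = let l , eq = m≤n⇒∃[o]m+o≡n lo<hi in l , trans (+-suc lo l) eq

  segment-members : ∀ {lo hi} l → lo + l ≡ hi → hi ≤ suc m → ∀ x → x ∈ segment lo l ⇔ Inside lo hi x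
  segment-members l eq hi≤n x = mk⇔ (segment-inside l eq hi≤n) (inside-segment l eq hi≤n)

  segment-edges : ∀ {lo hi} l → lo + suc l ≡ hi → hi ≤ suc m → ∀ x y →
    PathEdge (node lo ∷ segment (suc lo) l) x y ⇔ IntervalEdge line lo hi x y
  segment-edges {lo} {hi} l eq hi≤n x y = mk⇔ edge⁻ edge⁺
    where
    consecutive : ∀ {x y} → Consecutive (node lo ∷ segment (suc lo) l) x y →
      suc (toℕ x) ≡ toℕ y × Inside lo hi x × Inside lo hi y
    consecutive (us , vs , eq′) = segment-consecutive (suc l) eq hi≤n us eq′ ,
      segment-inside (suc l) eq hi≤n (subst (_ ∈_) (sym eq′) (∈-++⁺ʳ us (here refl))) ,
      segment-inside (suc l) eq hi≤n (subst (_ ∈_) (sym eq′) (∈-++⁺ʳ us (there (here refl))))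
    edge⁻ : PathEdge (node lo ∷ segment (suc lo) l) x y → IntervalEdge line lo hi x y
    edge⁻ (inj₁ c) = let e , x∈ , y∈ = consecutive c in inj₁ e , x∈ , y∈
    edge⁻ (inj₂ c) = let e , y∈ , x∈ = consecutive c in inj₂ e , x∈ , y∈
    edge⁺ : IntervalEdge line lo hi x y → PathEdge (node lo ∷ segment (suc lo) l) x y
    edge⁺ (inj₁ e , x∈ , y∈) = inj₁ (consecutive-segment (suc l) eq hi≤n e x∈ y∈)
    edge⁺ (inj₂ e , x∈ , y∈) = inj₂ (consecutive-segment (suc l) eq hi≤n e y∈ x∈)

  interval-admissible : ∀ K {lo hi} → lo < hi → hi ≤ suc m → Admissible K (interval {suc m} K lo hi)
  interval-admissible K {lo} lo<hi hi≤n with segment-length lo<hi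
  interval-admissible line {lo} lo<hi hi≤n | l , eq = line-admissible {suc m} (node lo ∷ segment (suc lo) l)
    (segment-unique (suc l) eq hi≤n) (segment-edges l eq hi≤n)
  interval-admissible clique {lo} lo<hi hi≤n | l , eq = clique-admissible {suc m} (node lo ∷ segment (suc lo) l)
    (segment-unique (suc l) eq hi≤n) (segment-members (suc l) eq hi≤n)

  -- One description of growth at either end, for both classes. The fields `close` and `only` say
  -- that a path gains exactly the edge between its end `a` and the new node `ν`.
  record Extension (lo hi lo′ hi′ : ℕ) : Set where
    field
      a ν     : Fin (suc m)
      a∈      : Inside lo hi a
      ν∉      : ¬ Inside lo hi ν
      close   : Close line a ν
      hi≤n    : hi ≤ suc m
      nodes   : ∀ x → Inside lo′ hi′ x ⇔ (Inside lo hi x ⊎ x ≡ ν)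
      only    : ∀ {x} → Inside lo hi x → Close line x ν → x ≡ a

  extend-step : ∀ K {lo hi lo′ hi′} → Extension lo hi lo′ hi′ →
    Step K (interval {suc m} K lo hi) (interval K lo′ hi′)
  extend-step line {lo} {hi} {lo′} {hi′} E = line-extend {suc m} a∈ ν∉ λ x y → mk⇔ (to x y) (from x y)
    where
    open Extension E
    to : ∀ x y → IntervalEdge line lo′ hi′ x y →
      IntervalEdge line lo hi x y ⊎ (x ≡ a × y ≡ ν) ⊎ (x ≡ ν × y ≡ a)
    to x y (c , x∈ , y∈) with Equivalence.to (nodes x) x∈ | Equivalence.to (nodes y) y∈
    ... | inj₁ x∈   | inj₁ y∈   = inj₁ (c , x∈ , y∈)
    ... | inj₁ x∈   | inj₂ refl = inj₂ (inj₁ (only x∈ c , refl))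
    ... | inj₂ refl | inj₁ y∈   = inj₂ (inj₂ (refl , only y∈ (close-sym line c)))
    ... | inj₂ refl | inj₂ refl = contradiction c (close-irrefl line ν)
    from : ∀ x y → IntervalEdge line lo hi x y ⊎ (x ≡ a × y ≡ ν) ⊎ (x ≡ ν × y ≡ a) →
      IntervalEdge line lo′ hi′ x y
    from x y (inj₁ (c , x∈ , y∈)) = c , Equivalence.from (nodes x) (inj₁ x∈) , Equivalence.from (nodes y) (inj₁ y∈)
    from x y (inj₂ (inj₁ (refl , refl))) = close , Equivalence.from (nodes a) (inj₁ a∈) , Equivalence.from (nodes ν) (inj₂ refl)
    from x y (inj₂ (inj₂ (refl , refl))) = close-sym line close , Equivalence.from (nodes ν) (inj₂ refl) , Equivalence.from (nodes a) (inj₁ a∈)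
  extend-step clique {lo} {hi} {lo′} {hi′} E =
    clique-merge {suc m} (node lo ∷ segment (suc lo) l) ν
      (Unique.++⁺ (segment-unique (suc l) eq hi≤n) ([] ∷ [])
        λ { (x∈ , here refl) → ν∉ (segment-inside (suc l) eq hi≤n x∈) })
      (segment-members (suc l) eq hi≤n)
      λ x → mk⇔
        (λ x∈ → Equivalence.from (nodes x) (Sum.map (segment-inside (suc l) eq hi≤n) singleton⁻ (∈-++⁻ (segment lo (suc l)) x∈)))
        (λ x∈ → Sum.[ ∈-++⁺ˡ ∘ inside-segment (suc l) eq hi≤n , ∈-++⁺ʳ (segment lo (suc l)) ∘ here ]′ (Equivalence.to (nodes x) x∈))
    where
    open Extension E
    lo<hi : lo < hi
    lo<hi = ≤-<-trans (proj₁ a∈) (proj₂ a∈)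
    l = proj₁ (segment-length lo<hi)
    eq : lo + suc l ≡ hi
    eq = proj₂ (segment-length lo<hi)
    singleton⁻ : ∀ {x} → x ∈ [ ν ] → x ≡ ν
    singleton⁻ (here x≡ν) = x≡ν

  extend-right : ∀ {lo hi} → lo < hi → hi < suc m → Extension lo hi lo (suc hi)
  extend-right {lo} {suc hi} (s≤s lo≤hi) hi<n = record
    { a     = node hi
    ; ν     = node (suc hi)
    ; a∈    = subst (λ t → lo ≤ t × t < suc hi) (sym toℕ-a) (lo≤hi , ≤-refl)
    ; ν∉    = λ (_ , ν<) → <-irrefl refl (subst (_< suc hi) toℕ-ν ν<)
    ; close = inj₁ (trans (cong suc toℕ-a) (sym toℕ-ν))
    ; hi≤n  = <⇒≤ hi<n
    ; nodes = λ x → mk⇔ (to x) (from x)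
    ; only  = only
    }
    where
    toℕ-a : toℕ (node hi) ≡ hi
    toℕ-a = toℕ-node (<-trans ≤-refl hi<n)
    toℕ-ν : toℕ (node (suc hi)) ≡ suc hi
    toℕ-ν = toℕ-node hi<n
    to : ∀ x → Inside lo (suc (suc hi)) x → Inside lo (suc hi) x ⊎ x ≡ node (suc hi)
    to x (lo≤x , x<) with toℕ x ≟ suc hi
    ... | yes x≡ = inj₂ (toℕ-injective (trans x≡ (sym toℕ-ν)))
    ... | no x≢  = inj₁ (lo≤x , ≤∧≢⇒< (s≤s⁻¹ x<) x≢)
    from : ∀ x → Inside lo (suc hi) x ⊎ x ≡ node (suc hi) → Inside lo (suc (suc hi)) x
    from x (inj₁ (lo≤x , x<)) = lo≤x , m<n⇒m<1+n x<
    from x (inj₂ refl) = subst (λ t → lo ≤ t × t < suc (suc hi)) (sym toℕ-ν) (m≤n⇒m≤1+n lo≤hi , ≤-refl)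
    only : ∀ {x} → Inside lo (suc hi) x → Close line x (node (suc hi)) → x ≡ node hi
    only (_ , x<) (inj₁ eq) = toℕ-injective (trans (suc-injective (trans eq toℕ-ν)) (sym toℕ-a))
    only (_ , x<) (inj₂ eq) = contradiction (subst (_< suc hi) (trans (sym eq) (cong suc toℕ-ν)) x<) (<-asym ≤-refl)

  extend-left : ∀ {lo hi} → suc lo < hi → hi ≤ suc m → Extension (suc lo) hi lo hi
  extend-left {lo} {hi} 1+lo<hi hi≤n = record
    { a     = node (suc lo)
    ; ν     = node lo
    ; a∈    = subst (λ t → suc lo ≤ t × t < hi) (sym toℕ-a) (≤-refl , 1+lo<hi)
    ; ν∉    = λ (<ν , _) → <-irrefl refl (subst (lo <_) toℕ-ν <ν)
    ; close = inj₂ (trans (cong suc toℕ-ν) (sym toℕ-a))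
    ; hi≤n  = hi≤n
    ; nodes = λ x → mk⇔ (to x) (from x)
    ; only  = only
    }
    where
    lo<hi : lo < hi
    lo<hi = <-trans ≤-refl 1+lo<hi
    toℕ-a : toℕ (node (suc lo)) ≡ suc lo
    toℕ-a = toℕ-node (<-≤-trans 1+lo<hi hi≤n)
    toℕ-ν : toℕ (node lo) ≡ lo
    toℕ-ν = toℕ-node (<-≤-trans lo<hi hi≤n)
    to : ∀ x → Inside lo hi x → Inside (suc lo) hi x ⊎ x ≡ node lo
    to x (lo≤x , x<) with toℕ x ≟ lo
    ... | yes x≡ = inj₂ (toℕ-injective (trans x≡ (sym toℕ-ν)))
    ... | no x≢  = inj₁ (≤∧≢⇒< lo≤x (x≢ ∘ sym) , x<)
    from : ∀ x → Inside (suc lo) hi x ⊎ x ≡ node lo → Inside lo hi x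
    from x (inj₁ (lo≤x , x<)) = <⇒≤ lo≤x , x<
    from x (inj₂ refl) = subst (λ t → lo ≤ t × t < hi) (sym toℕ-ν) (≤-refl , lo<hi)
    only : ∀ {x} → Inside (suc lo) hi x → Close line x (node lo) → x ≡ node (suc lo)
    only {x} (lo<x , _) (inj₁ eq) = contradiction (subst (toℕ x <_) (trans eq toℕ-ν) ≤-refl) (<-asym lo<x)
    only (lo<x , _) (inj₂ eq) = toℕ-injective (trans (sym eq) (trans (cong suc toℕ-ν) (sym toℕ-a)))

-- Arrangements closest to the start

-- For an arbitrary predicate the least element cannot be computed, but strong induction refutes its
-- absence. Every use ends in a contradiction or in a decidable goal.
¬¬-minimum : ∀ {P : ℕ → Set} {m} → P m → ¬ ¬ ∃ λ d → d IsMinimumOf P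
¬¬-minimum {P} {m} pm none = <-rec (λ k → ¬ P k)
  (λ k smaller pk → none (k , pk , λ j pj → ≮⇒≥ λ j<k → smaller j<k pj)) m pm

punchIn-below : ∀ {n} (i : Fin (suc n)) a → toℕ a < toℕ i → toℕ (punchIn i a) ≡ toℕ a
punchIn-below (suc i) zero    a<i = refl
punchIn-below (suc i) (suc a) a<i = cong suc (punchIn-below i a (s≤s⁻¹ a<i))

punchIn-above : ∀ {n} (i : Fin (suc n)) a → toℕ i ≤ toℕ a → toℕ (punchIn i a) ≡ suc (toℕ a)
punchIn-above zero    a       i≤a = refl
punchIn-above (suc i) (suc a) i≤a = cong suc (punchIn-above i a (s≤s⁻¹ i≤a))

module _ {m : ℕ} where

  -- Node 0 plays the role of x: it is at position t ≤ m, and the other nodes are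
  -- in increasing order.
  placed : ℕ → Perm (suc m)
  placed t = insert zero (node t) id

  placed-left : ∀ {t} → t ≤ m → ∀ {x : Fin (suc m)} → 0 < toℕ x → toℕ x ≤ t →
    suc (toℕ (placed t ⟨$⟩ʳ x)) ≡ toℕ x
  placed-left {t} t≤m {suc u} _ u<t = cong suc (trans (cong toℕ (insert-punchIn zero (node t) id u))
    (punchIn-below (node t) u (subst (toℕ u <_) (sym (toℕ-node (s≤s t≤m))) u<t)))

  placed-right : ∀ {t} → t ≤ m → ∀ {x : Fin (suc m)} → t < toℕ x → toℕ (placed t ⟨$⟩ʳ x) ≡ toℕ x
  placed-right {t} t≤m {suc u} t≤u = trans (cong toℕ (insert-punchIn zero (node t) id u))
    (punchIn-above (node t) u (subst (_≤ toℕ u) (sym (toℕ-node (s≤s t≤m))) (s≤s⁻¹ t≤u)))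

  placed-shifted-left : ∀ {t lo hi} → t ≤ m → t < lo → Shifted (placed t) lo hi
  placed-shifted-left t≤m t<lo = inj₁ λ x (lo≤x , _) → placed-right t≤m (<-≤-trans t<lo lo≤x)

  placed-shifted-right : ∀ {t lo hi} → t ≤ m → 0 < lo → hi ≤ suc t → Shifted (placed t) lo hi
  placed-shifted-right t≤m 0<lo hi≤1+t = inj₂ λ x (lo≤x , x<hi) →
    placed-left t≤m (<-≤-trans 0<lo lo≤x) (s≤s⁻¹ (<-≤-trans x<hi hi≤1+t))

  placed-before : ∀ {t} → t ≤ m → ∀ {x : Fin (suc m)} → t < toℕ x → Before (placed t) zero x
  placed-before {t} t≤m t<x = subst₂ _<_ (sym (toℕ-node (s≤s t≤m))) (sym (placed-right t≤m t<x)) t<x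

  placed-¬before : ∀ {t} → t ≤ m → ∀ {x : Fin (suc m)} → 0 < toℕ x → toℕ x ≤ t → ¬ Before (placed t) zero x
  placed-¬before {t} t≤m {x} 0<x x≤t 0<px = <-irrefl refl (<-trans
    (<-≤-trans (≤-reflexive (placed-left t≤m 0<x x≤t)) x≤t)
    (subst (_< toℕ (placed t ⟨$⟩ʳ x)) (toℕ-node (s≤s t≤m)) 0<px))

  ≢node : ∀ {p : Fin (suc m)} {t} → t ≤ m → toℕ p ≢ t → p ≢ node t
  ≢node t≤m p≢t p≡ = p≢t (trans (cong toℕ p≡) (toℕ-node (s≤s t≤m)))

  -- Node `suc t` stands directly to the right of node 0 in `placed t`, and the two are exchanged;
  -- all other nodes keep their positions.
  placed-step : ∀ {t} → suc t ≤ m → placed t ∘ₚ transpose (node t) (node (suc t)) ≈ placed (suc t)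
  placed-step {t} t<m zero = transpose-first (node t) (node (suc t))
  placed-step {t} t<m x@(suc _) with <-cmp (toℕ x) (suc t)
  ... | tri< x<1+t _ _ = trans (transpose-other (≢node (<⇒≤ t<m) (<⇒≢ p<t)) (≢node t<m (<⇒≢ (m<n⇒m<1+n p<t))))
          (toℕ-injective (suc-injective (trans 1+p≡x (sym (placed-left t<m (s≤s z≤n) (<⇒≤ x<1+t))))))
    where
    1+p≡x : suc (toℕ (placed t ⟨$⟩ʳ x)) ≡ toℕ x
    1+p≡x = placed-left (<⇒≤ t<m) (s≤s z≤n) (s≤s⁻¹ x<1+t)
    p<t : toℕ (placed t ⟨$⟩ʳ x) < t
    p<t = <-≤-trans (≤-reflexive 1+p≡x) (s≤s⁻¹ x<1+t)
  ... | tri≈ _ x≡1+t _ = begin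
      PC.transpose (node t) (node (suc t)) (placed t ⟨$⟩ʳ x)
        ≡⟨ cong (PC.transpose (node t) (node (suc t))) (toℕ-injective (trans p≡1+t (sym (toℕ-node (s≤s t<m))))) ⟩
      PC.transpose (node t) (node (suc t)) (node (suc t))
        ≡⟨ transpose-second (node t) (node (suc t)) ⟩
      node t
        ≡⟨ toℕ-injective (trans (toℕ-node (s≤s (<⇒≤ t<m))) (suc-injective (sym (trans (placed-left t<m (s≤s z≤n) (≤-reflexive x≡1+t)) x≡1+t)))) ⟩
      placed (suc t) ⟨$⟩ʳ x ∎
    where
    open ≡-Reasoning
    p≡1+t : toℕ (placed t ⟨$⟩ʳ x) ≡ suc t
    p≡1+t = trans (placed-right (<⇒≤ t<m) (≤-reflexive (sym x≡1+t))) x≡1+t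
  ... | tri> _ _ 1+t<x = trans
          (transpose-other (≢node (<⇒≤ t<m) (>⇒≢ (subst (t <_) (sym p≡x) (<-trans ≤-refl 1+t<x))))
            (≢node t<m (>⇒≢ (subst (suc t <_) (sym p≡x) 1+t<x))))
          (toℕ-injective (trans p≡x (sym (placed-right t<m 1+t<x))))
    where
    p≡x : toℕ (placed t ⟨$⟩ʳ x) ≡ toℕ x
    p≡x = placed-right (<⇒≤ t<m) (<-trans ≤-refl 1+t<x)

  node-adjacent : ∀ {t} → suc t ≤ m → toℕ (node (suc t)) ≡ suc (toℕ (node t))
  node-adjacent {t} t<m =
    trans (toℕ-node (s≤s t<m)) (cong suc (sym (toℕ-node (s≤s (<⇒≤ t<m)))))

  swaps-right : ∀ d {t} → d + t ≤ m → Swaps d (placed t) (placed (d + t))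
  swaps-right zero    d+t≤m = done λ _ → refl
  swaps-right (suc d) {t} d+t≤m =
    swap (node t , node (suc t) , node-adjacent t<m , placed-step t<m)
      (subst (λ s → Swaps d (placed (suc t)) (placed s)) (+-suc d t)
        (swaps-right d (subst (_≤ m) (sym (+-suc d t)) d+t≤m)))
    where
    t<m : suc t ≤ m
    t<m = ≤-trans (s≤s (m≤n+m t d)) d+t≤m

  swaps-left : ∀ d {t} → d + t ≤ m → Swaps d (placed (d + t)) (placed t)
  swaps-left zero    d+t≤m = done λ _ → refl
  swaps-left (suc d) {t} d+t<m =
    swap (node (d + t) , node (suc (d + t)) , node-adjacent d+t<m , λ x → begin
        PC.transpose i j (placed (suc (d + t)) ⟨$⟩ʳ x) ≡⟨ transpose-comm i j (placed (suc (d + t)) ⟨$⟩ʳ x) ⟩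
        PC.transpose j i (placed (suc (d + t)) ⟨$⟩ʳ x) ≡⟨ cong (PC.transpose j i) (placed-step d+t<m x) ⟨
        PC.transpose j i (PC.transpose i j (placed (d + t) ⟨$⟩ʳ x)) ≡⟨ PC.transpose-inverse j i ⟩
        placed (d + t) ⟨$⟩ʳ x ∎)
      (swaps-left d (<⇒≤ d+t<m))
    where
    open ≡-Reasoning
    i = node (d + t)
    j = node (suc (d + t))

  flips≤swaps-interval : ∀ {π ρ : Perm (suc m)} {d} → Swaps d π ρ → ∀ {lo} k → 0 < lo → lo + k ≤ suc m →
    (∀ x → Inside lo (lo + k) x → ¬ SameOrder π ρ zero x) → k ≤ d
  flips≤swaps-interval ss {lo} k 0<lo lo+k≤n flips = flips≤swaps zero ss f f-injective
    λ a → (λ fa≡0 → <-irrefl (sym (cong toℕ fa≡0)) (<-≤-trans 0<lo (subst (lo ≤_) (sym (toℕ-f a)) (m≤m+n lo (toℕ a))))) ,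
      flips (f a) (subst (λ t → lo ≤ t × t < lo + k) (sym (toℕ-f a)) (m≤m+n lo (toℕ a) , +-monoʳ-< lo (Fin.toℕ<n a)))
    where
    f : Fin k → Fin (suc m)
    f a = node (lo + toℕ a)
    toℕ-f : ∀ a → toℕ (f a) ≡ lo + toℕ a
    toℕ-f a = toℕ-node (<-≤-trans (+-monoʳ-< lo (Fin.toℕ<n a)) lo+k≤n)
    f-injective : ∀ {a b} → f a ≡ f b → a ≡ b
    f-injective {a} {b} eq = toℕ-injective (+-cancelˡ-≡ lo _ _
      (trans (sym (toℕ-f a)) (trans (cong toℕ eq) (toℕ-f b))))

  module _ {K : Class} {lo hi : ℕ} (0<lo : 0 < lo) {ρ : Perm (suc m)} (min : MinLA (interval K lo hi) ρ) where

    private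
      forward : ∀ {x y : Fin (suc m)} → Close K x y → Inside lo hi x → Inside lo hi y →
        Before ρ zero x → Before ρ zero y
      forward {zero}          c (lo≤0 , _) y∈ = contradiction (<-≤-trans 0<lo lo≤0) λ ()
      forward {suc _} {zero}  c x∈ (lo≤0 , _) = contradiction (<-≤-trans 0<lo lo≤0) λ ()
      forward {suc u} {suc v} c x∈ y∈ = MinLA-isolated {G = interval K lo hi} {ρ} min
        (interval-outside K λ (lo≤0 , _) → contradiction (<-≤-trans 0<lo lo≤0) λ ())
        (Equivalence.from (interval-adj K lo hi (suc u) (suc v)) (c , x∈ , y∈))

      walk : ∀ d {x y} → toℕ y ≡ d + toℕ x → Inside lo hi x → Inside lo hi y → Before ρ zero x ⇔ Before ρ zero y
      walk zero eq x∈ y∈ rewrite toℕ-injective eq = ⇔-id _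
      walk (suc d) {x} {y} eq x∈@(lo≤x , x<hi) y∈ = ⇔-trans (walk d toℕ-z x∈ z∈)
        (mk⇔ (forward c z∈ y∈) (forward (close-sym K c) y∈ z∈))
        where
        z = node (d + toℕ x)
        d+x<y : d + toℕ x < toℕ y
        d+x<y = ≤-reflexive (sym eq)
        toℕ-z : toℕ z ≡ d + toℕ x
        toℕ-z = toℕ-node (<-trans d+x<y (Fin.toℕ<n y))
        z∈ : Inside lo hi z
        z∈ = subst (λ t → lo ≤ t × t < hi) (sym toℕ-z) (≤-trans lo≤x (m≤n+m _ d) , <-trans d+x<y (proj₂ y∈))
        c : Close K z y
        c = close-suc K (trans (cong suc toℕ-z) (sym eq))

    -- In both classes consecutive labels are adjacent, and `MinLA-isolated` forbids node 0 to stand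
    -- between the ends of an edge. The order relative to node 0 therefore propagates along the
    -- labels from one node to the other.
    MinLA-same-side : ∀ {x y} → Inside lo hi x → Inside lo hi y → Before ρ zero x → Before ρ zero y
    MinLA-same-side {x} {y} x∈ y∈ with ≤-total (toℕ x) (toℕ y)
    ... | inj₁ x≤y = Equivalence.to (walk _ (sym (m∸n+n≡m x≤y)) x∈ y∈)
    ... | inj₂ y≤x = Equivalence.from (walk _ (sym (m∸n+n≡m y≤x)) y∈ x∈)

  -- Any MinLA `τ` that is reachable by `j` swaps bounds the distance of the closest one; the exact
  -- distances to `ρ` and `τ` are available only under double negation.
  closest-swaps : ∀ {π G} {ρ τ : Perm (suc m)} {j} → ClosestMinLA π G ρ → MinLA G τ → Swaps j π τ →
    ¬ ¬ ∃ λ d → d ≤ j × Swaps d π ρ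
  closest-swaps {π} {ρ = ρ} {τ} {j} (_ , closest) min ss none =
    ¬¬-minimum (proj₂ (swaps-connected π ρ)) λ (d , kd) →
    ¬¬-minimum ss λ (e , ke) →
    none (d , ≤-trans (closest τ min d e kd ke) (proj₂ ke j ss) , proj₁ kd)

  AllAfter AllBefore : ℕ → ℕ → Perm (suc m) → Set
  AllAfter  lo hi ρ = ∀ x → Inside lo hi x → Before ρ zero x
  AllBefore lo hi ρ = ∀ x → Inside lo hi x → ¬ Before ρ zero x

  -- The interval has `i` nodes to the left of node 0 in `placed c` and `j` to the right. Moving
  -- node 0 past the right ones takes `j` swaps and gives a MinLA. A MinLA with node 0 in front of
  -- the interval would reverse the order with all `i` left nodes, and this takes at least `i`
  -- swaps.
  closest-allBefore : ∀ {K lo c i j} {ρ : Perm (suc m)} → 0 < lo → lo + i ≡ suc c → j < i → c + j ≤ m →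
    ClosestMinLA (placed c) (interval K lo (suc c + j)) ρ → AllBefore lo (suc c + j) ρ
  closest-allBefore {K} {lo} {c} {i} {j} {ρ} 0<lo lo+i≡1+c j<i c+j≤m cl x x∈ 0<x =
    closest-swaps {G = interval K lo (suc c + j)} {ρ} cl
      (shifted-MinLA K {placed (j + c)} (placed-shifted-right j+c≤m 0<lo (≤-reflexive (cong suc (+-comm c j)))))
      (swaps-right j j+c≤m)
      λ (d , d≤j , ss) → <-irrefl refl (<-≤-trans j<i (≤-trans (flips≤swaps-interval ss i 0<lo
          (≤-trans (≤-reflexive lo+i≡1+c) (s≤s (≤-trans (m≤m+n c j) c+j≤m))) flips) d≤j))
    where
    j+c≤m : j + c ≤ m
    j+c≤m = subst (_≤ m) (+-comm c j) c+j≤m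
    flips : ∀ y → Inside lo (lo + i) y → ¬ SameOrder (placed c) ρ zero y
    flips y (lo≤y , y<) same = placed-¬before (≤-trans (m≤m+n c j) c+j≤m) (<-≤-trans 0<lo lo≤y) (s≤s⁻¹ y<1+c)
      (Equivalence.from same (MinLA-same-side {K} 0<lo {ρ} (proj₁ cl) x∈ (lo≤y , <-≤-trans y<1+c (m≤m+n (suc c) j)) 0<x))
      where
      y<1+c : toℕ y < suc c
      y<1+c = subst (toℕ y <_) lo+i≡1+c y<

  -- Mirror image: `placed t` is a MinLA at `i` swaps, while leaving node 0 behind the interval
  -- would flip all `j` nodes on the right.
  closest-allAfter : ∀ {K t c i j} {ρ : Perm (suc m)} → i + t ≡ c → i < j → c + j ≤ m →
    ClosestMinLA (placed c) (interval K (suc t) (suc c + j)) ρ → AllAfter (suc t) (suc c + j) ρ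
  closest-allAfter {K} {t} {c} {i} {j} {ρ} refl i<j c+j≤m cl x x∈ =
    decidable-stable (_ <? _) λ 0≮x →
    closest-swaps {G = interval K (suc t) (suc c + j)} {ρ} cl
      (shifted-MinLA K {placed t} (placed-shifted-left (≤-trans (m≤n+m t i) c≤m) ≤-refl))
      (swaps-left i c≤m)
      λ (d , d≤i , ss) → <-irrefl refl (<-≤-trans i<j (≤-trans (flips≤swaps-interval ss j (s≤s z≤n) (s≤s c+j≤m)
        (flips 0≮x)) d≤i))
    where
    c≤m : c ≤ m
    c≤m = ≤-trans (m≤m+n c j) c+j≤m
    flips : ¬ Before ρ zero x → ∀ y → Inside (suc c) (suc c + j) y → ¬ SameOrder (placed c) ρ zero y
    flips 0≮x y (c<y , y<) same = 0≮x (MinLA-same-side {K} (s≤s z≤n) {ρ} (proj₁ cl)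
      (≤-trans (s≤s (m≤n+m t i)) c<y , y<) x∈
      (Equivalence.to same (placed-before c≤m c<y)))

-- The adversarial instance

-- The nodes next to node 0 join in the order left, right, right, left, left,
-- right, right, …, so that after every other step the majority changes.
lefts rights : ℕ → ℕ
lefts 0 = 1
lefts 1 = 1
lefts 2 = 1
lefts 3 = 2
lefts (suc (suc (suc (suc t)))) = 2 + lefts t
rights 0 = 0
rights 1 = 1
rights 2 = 2
rights 3 = 2
rights (suc (suc (suc (suc t)))) = 2 + rights t

lefts>0 : ∀ t → 0 < lefts t
lefts>0 0 = s≤s z≤n
lefts>0 1 = s≤s z≤n
lefts>0 2 = s≤s z≤n
lefts>0 3 = s≤s z≤n
lefts>0 (suc (suc (suc (suc t)))) = s≤s z≤n

growth : ∀ t → (lefts (suc t) ≡ lefts t × rights (suc t) ≡ suc (rights t)) ⊎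
               (lefts (suc t) ≡ suc (lefts t) × rights (suc t) ≡ rights t)
growth 0 = inj₁ (refl , refl)
growth 1 = inj₁ (refl , refl)
growth 2 = inj₂ (refl , refl)
growth 3 = inj₂ (refl , refl)
growth (suc (suc (suc (suc t)))) with growth t
... | inj₁ (l , r) = inj₁ (cong (2 +_) l , cong (2 +_) r)
... | inj₂ (l , r) = inj₂ (cong (2 +_) l , cong (2 +_) r)

lefts-bound : ∀ S t → t ≤ S * 4 → lefts t ≤ 1 + S * 2
lefts-bound S       0 _ = s≤s z≤n
lefts-bound S       1 _ = s≤s z≤n
lefts-bound S       2 _ = s≤s z≤n
lefts-bound (suc S) 3 _ = s≤s (s≤s z≤n)
lefts-bound (suc S) (suc (suc (suc (suc t)))) (s≤s (s≤s (s≤s (s≤s t≤)))) = s≤s (s≤s (lefts-bound S t t≤))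

rights-bound : ∀ S t → t ≤ S * 4 → rights t ≤ S * 2
rights-bound S       0 _ = z≤n
rights-bound (suc S) 1 _ = s≤s z≤n
rights-bound (suc S) 2 _ = s≤s (s≤s z≤n)
rights-bound (suc S) 3 _ = s≤s (s≤s z≤n)
rights-bound (suc S) (suc (suc (suc (suc t)))) (s≤s (s≤s (s≤s (s≤s t≤)))) = s≤s (s≤s (rights-bound S t t≤))

lefts-mod0 : ∀ s → lefts (s * 4) ≡ 1 + s * 2
lefts-mod0 zero    = refl
lefts-mod0 (suc s) = cong (2 +_) (lefts-mod0 s)

rights-mod0 : ∀ s → rights (s * 4) ≡ s * 2
rights-mod0 zero    = refl
rights-mod0 (suc s) = cong (2 +_) (rights-mod0 s)

lefts-mod2 : ∀ s → lefts (2 + s * 4) ≡ 1 + s * 2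
lefts-mod2 zero    = refl
lefts-mod2 (suc s) = cong (2 +_) (lefts-mod2 s)

rights-mod2 : ∀ s → rights (2 + s * 4) ≡ 2 + s * 2
rights-mod2 zero    = refl
rights-mod2 (suc s) = cong (2 +_) (rights-mod2 s)

¬¬-finite-choice : ∀ {n} {P : Fin n → Set} → (∀ i → ¬ ¬ P i) → ¬ ¬ (∀ i → P i)
¬¬-finite-choice {zero}  h k = k λ ()
¬¬-finite-choice {suc n} h k = h zero λ p → ¬¬-finite-choice (h ∘ suc) λ ps →
  k λ { zero → p ; (suc i) → ps i }

-- `Q` records what is known at each time, and `w s` is the price of going from time `4s` to
-- `4s + 2`. Both are parameters so that the induction can drop the first four steps by shifting
-- them.
sum-blocks : ∀ {n} S (Q : ℕ → Perm n → Set) (w : ℕ → ℕ) →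
  (∀ s {π ρ d} → s < S → Q (s * 4) π → Q (2 + s * 4) ρ → Swaps d π ρ → w s ≤ d) →
  (τ : Fin (suc (S * 4)) → Perm n) → (∀ i → Q (toℕ i) (τ i)) →
  (d : Fin (S * 4) → ℕ) → (∀ i → Swaps (d i) (τ (inject₁ i)) (τ (suc i))) →
  ∑[ s < S ] w (toℕ s) ≤ List.sum (tabulate d)
sum-blocks zero    Q w block τ q d ss = z≤n
sum-blocks (suc S) Q w block τ q d ss = ≤-trans
  (+-mono-≤ (block 0 (s≤s z≤n) (q zero) (q (suc (suc zero))) (swaps-trans (ss zero) (ss (suc zero))))
    (≤-trans (sum-blocks S (λ t → Q (4 + t)) (w ∘ suc) (λ s s<S → block (suc s) (s≤s s<S))
      (λ i → τ (suc (suc (suc (suc i))))) (λ i → q (suc (suc (suc (suc i)))))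
      (λ i → d (suc (suc (suc (suc i))))) (λ i → ss (suc (suc (suc (suc i))))))
      -- The last two steps of the block, which bring the majority back, are bounded below by zero.
      (≤-trans (m≤n+m _ (d (suc (suc zero)) + d (suc (suc (suc zero))))) (≤-reflexive (+-assoc (d (suc (suc zero))) _ _)))))
  (≤-reflexive (+-assoc (d zero) (d (suc zero)) _))

-- Stated with `S * 2` on the left to avoid subtraction. The offset `b` is general because removing
-- the first term raises it by 4.
sum-arithmetic : ∀ S b → (∑[ s < S ] (b + toℕ s * 4)) + S * 2 ≡ S * b + S * S * 2
sum-arithmetic zero    b = refl
sum-arithmetic (suc S) b = begin
  b + 0 + (∑[ s < S ] (b + suc (toℕ s) * 4)) + suc S * 2
    ≡⟨ cong (λ t → b + 0 + t + suc S * 2) (sum-cong-≗ {S} λ s → shift b (toℕ s)) ⟩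
  b + 0 + (∑[ s < S ] (4 + b + toℕ s * 4)) + suc S * 2
    ≡⟨ regroup b S _ ⟩
  b + 2 + ((∑[ s < S ] (4 + b + toℕ s * 4)) + S * 2)
    ≡⟨ cong (b + 2 +_) (sum-arithmetic S (4 + b)) ⟩
  b + 2 + (S * (4 + b) + S * S * 2)
    ≡⟨ expand b S ⟩
  suc S * b + suc S * suc S * 2 ∎
  where
  open ≡-Reasoning
  shift : ∀ b s → b + suc s * 4 ≡ 4 + b + s * 4
  shift = solve-∀
  regroup : ∀ b S t → b + 0 + t + suc S * 2 ≡ b + 2 + (t + S * 2)
  regroup = solve-∀
  expand : ∀ b S → b + 2 + (S * (4 + b) + S * S * 2) ≡ suc S * b + suc S * suc S * 2
  expand = solve-∀

module Adversary (K : Class) (S m : ℕ) (fits : 2 + S * 4 ≤ m) where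

  -- In the start arrangement nodes 1, ..., `c` precede node 0. By `lefts-bound` at most this many
  -- ever join from the left, so `c ∸ lefts t` never truncates.
  c : ℕ
  c = 1 + S * 2

  lo hi : ℕ → ℕ
  lo t = suc (c ∸ lefts t)
  hi t = suc c + rights t

  c+rights≤m : ∀ {t} → t ≤ S * 4 → c + rights t ≤ m
  c+rights≤m {t} t≤ = ≤-trans (+-monoʳ-≤ c (≤-trans (rights-bound S t t≤) (n≤1+n _)))
    (≤-trans (≤-reflexive (double S)) fits)
    where
    double : ∀ S → 1 + S * 2 + (1 + S * 2) ≡ 2 + S * 4
    double = solve-∀

  c≤m : c ≤ m
  c≤m = ≤-trans (m≤m+n c (rights 0)) (c+rights≤m z≤n)

  hi≤n : ∀ {t} → t ≤ S * 4 → hi t ≤ suc m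
  hi≤n t≤ = s≤s (c+rights≤m t≤)

  lo<hi : ∀ {t} → t ≤ S * 4 → lo t < hi t
  lo<hi {t} t≤ = s≤s (≤-trans (m∸n+n≤c) (m≤m+n c (rights t)))
    where
    m∸n+n≤c : suc (c ∸ lefts t) ≤ c
    m∸n+n≤c = ∸-monoʳ-< (lefts>0 t) (lefts-bound S t t≤)

  graph : ℕ → Graph (suc m)
  graph t = interval K (lo t) (hi t)

  extension : ∀ {t} → suc t ≤ S * 4 → Extension {m} (lo t) (hi t) (lo (suc t)) (hi (suc t))
  extension {t} t< with growth t
  ... | inj₁ (l , r) = subst₂ (λ a b → Extension (lo t) (hi t) (suc (c ∸ a)) (suc c + b)) (sym l) (sym r)
      (subst (Extension (lo t) (hi t) (lo t)) (sym (+-suc (suc c) (rights t)))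
        (extend-right (lo<hi (<⇒≤ t<)) (≤-trans (≤-reflexive (sym (trans (cong (suc c +_) r) (+-suc (suc c) (rights t))))) (hi≤n t<))))
  ... | inj₂ (l , r) = subst₂ (λ a b → Extension (lo t) (hi t) (suc (c ∸ a)) (suc c + b)) (sym l) (sym r)
      (subst (λ a → Extension {m} a (hi t) (suc (c ∸ suc (lefts t))) (hi t)) (cong suc eq)
        (extend-left (subst (_< hi t) (sym (cong suc eq)) (lo<hi (<⇒≤ t<))) (hi≤n (<⇒≤ t<))))
    where
    eq : suc (c ∸ suc (lefts t)) ≡ c ∸ lefts t
    eq = sym (+-∸-assoc 1 (subst (_≤ c) l (lefts-bound S (suc t) t<)))

  σ : Instance K (suc m)
  σ = record
    { start      = placed c
    ; k          = S * 4
    ; graph      = λ i → graph (toℕ i)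
    ; edgeless   = λ x y e → edgeless (Equivalence.to (interval-adj K (lo 0) (hi 0) x y) e)
    ; admissible = λ i → interval-admissible K (lo<hi (s≤s⁻¹ (Fin.toℕ<n i))) (hi≤n (s≤s⁻¹ (Fin.toℕ<n i)))
    ; step       = λ i → subst (λ t → Step K (graph t) (graph (suc (toℕ i)))) (sym (Fin.toℕ-inject₁ i))
                     (extend-step K (extension (Fin.toℕ<n i)))
    }
    where
    -- At time 0 the interval is the single node `c`, since `lefts 0` is 1 and `rights 0` is 0.
    edgeless : ∀ {x y} → ¬ IntervalEdge K (lo 0) (hi 0) x y
    edgeless {x} {y} (close , (lo≤x , x<hi) , (lo≤y , y<hi)) =
      close-irrefl K y (subst (λ z → Close K z y) (toℕ-injective (trans (squeeze lo≤x x<hi) (sym (squeeze lo≤y y<hi)))) close)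
      where
      squeeze : ∀ {p} → lo 0 ≤ p → p < hi 0 → p ≡ c
      squeeze lo≤p p<hi = ≤-antisym (≤-trans (s≤s⁻¹ p<hi) (≤-reflexive (+-identityʳ c))) lo≤p

  -- Both implications are vacuous at a tie, where a closest MinLA may have node 0 on either side.
  Sides : ℕ → Perm (suc m) → Set
  Sides t ρ = (rights t < lefts t → AllBefore (lo t) (hi t) ρ) ×
              (lefts t < rights t → AllAfter (lo t) (hi t) ρ)

  lo+lefts : ∀ {t} → t ≤ S * 4 → lo t + lefts t ≡ suc c
  lo+lefts {t} t≤ = cong suc (m∸n+n≡m (lefts-bound S t t≤))

  start-sides : Sides 0 (placed c)
  start-sides = (λ _ x (lo≤x , x<hi) → placed-¬before c≤m (≤-trans (s≤s z≤n) lo≤x)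
    (≤-trans (s≤s⁻¹ x<hi) (≤-reflexive (+-identityʳ c)))) , λ ()

  closest-sides : ∀ {t ρ} → t ≤ S * 4 → ClosestMinLA (placed c) (graph t) ρ → Sides t ρ
  closest-sides {t} t≤ cl =
    (λ r<l → closest-allBefore {K = K} (s≤s z≤n) (lo+lefts t≤) r<l (c+rights≤m t≤) cl) ,
    (λ l<r → closest-allAfter {K = K} (trans (+-comm (lefts t) _) (suc-injective (lo+lefts t≤))) l<r (c+rights≤m t≤) cl)

  -- From time `4s` to `4s + 2` only right nodes join, so the later interval contains the earlier
  -- one. All `1 + 4s` nodes of the earlier interval change sides relative to node 0.
  block : ∀ s {π ρ d} → s < S → Sides (s * 4) π → Sides (2 + s * 4) ρ → Swaps d π ρ → 1 + s * 4 ≤ d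
  block s {π} {ρ} {d} s<S (before , _) (_ , after) ss = subst (_≤ d) size
    (flips≤swaps-interval ss (lefts t + rights t) (s≤s z≤n) (≤-trans (≤-reflexive end) (hi≤n t≤))
      λ x x∈ same → before majority x (subst (λ h → Inside (lo t) h x) end x∈)
        (Equivalence.from same (after majority′ x (inside x∈))))
    where
    t = s * 4
    t≤ : t ≤ S * 4
    t≤ = *-monoˡ-≤ 4 (<⇒≤ s<S)
    majority : rights t < lefts t
    majority = subst₂ _<_ (sym (rights-mod0 s)) (sym (lefts-mod0 s)) ≤-refl
    majority′ : lefts (2 + t) < rights (2 + t)
    majority′ = subst₂ _<_ (sym (lefts-mod2 s)) (sym (rights-mod2 s)) ≤-refl
    size : lefts t + rights t ≡ 1 + s * 4
    size = trans (cong₂ _+_ (lefts-mod0 s) (rights-mod0 s)) (double s)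
      where
      double : ∀ s → 1 + s * 2 + s * 2 ≡ 1 + s * 4
      double = solve-∀
    end : lo t + (lefts t + rights t) ≡ hi t
    end = trans (sym (+-assoc (lo t) (lefts t) (rights t))) (cong (_+ rights t) (lo+lefts t≤))
    inside : ∀ {x : Fin (suc m)} → Inside (lo t) (lo t + (lefts t + rights t)) x → Inside (lo (2 + t)) (hi (2 + t)) x
    inside {x} (lo≤x , x<) =
      subst (_≤ toℕ x) (cong (λ l → suc (c ∸ l)) (trans (lefts-mod0 s) (sym (lefts-mod2 s)))) lo≤x ,
      <-≤-trans (subst (toℕ x <_) end x<) (+-monoʳ-≤ (suc c)
        (subst₂ _≤_ (sym (rights-mod0 s)) (sym (rights-mod2 s)) (m≤n+m _ 2)))

  alg-cost : ∀ A → StaysClosestToStart K A → ∀ {a} → HasCost σ (run A σ) a →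
    S * 1 + S * S * 2 ≤ a + S * 2
  alg-cost A closest {a} (d , kd , a≡) = subst₂ _≤_ (sum-arithmetic S 1) (cong (_+ S * 2) (sym a≡))
    (+-monoˡ-≤ (S * 2) (sum-blocks S Sides (λ s → 1 + s * 4) block (trajectory σ (run A σ)) sides d (proj₁ ∘ kd)))
    where
    sides : ∀ i → Sides (toℕ i) (trajectory σ (run A σ) i)
    sides zero    = start-sides
    sides (suc i) = closest-sides (Fin.toℕ<n i) (closest σ i)

  stay : Solution σ
  stay _ = placed 0

  stay-feasible : Feasible σ stay
  stay-feasible i = shifted-MinLA K {placed 0} {lo (suc (toℕ i))} {hi (suc (toℕ i))}
    (placed-shifted-left z≤n (s≤s z≤n))

  ¬¬-stay-cost : ¬ ¬ ∃ λ e → e ≤ c × HasCost σ stay e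
  ¬¬-stay-cost none = ¬¬-minimum go λ (d₀ , k₀) →
    none (_ , ≤-trans (at-most d₀ (S * 4)) (proj₂ k₀ c go) , d d₀ ∘ inject₁ , kendall k₀ ∘ inject₁ , refl)
    where
    go : Swaps c (placed c) (placed {m} 0)
    go = subst (λ t → Swaps c (placed {m} t) (placed 0)) (+-identityʳ c)
      (swaps-left c (≤-trans (≤-reflexive (+-identityʳ c)) c≤m))
    -- The whole cost arises in the first step. Indexing by the departure time `inject₁ i` lets
    -- `trajectory` reduce by cases, and also covers the instance without steps.
    d : ∀ {k} → ℕ → Fin (suc k) → ℕ
    d d₀ zero    = d₀
    d d₀ (suc i) = 0
    at-most : ∀ d₀ k → List.sum (tabulate {n = k} (d d₀ ∘ inject₁)) ≤ d₀
    at-most d₀ zero    = z≤n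
    at-most d₀ (suc k) = ≤-reflexive (trans (cong (d₀ +_) (trans (sum-tabulate {k} (λ _ → 0)) (sum-zero k))) (+-identityʳ d₀))
    kendall : ∀ {d₀} → KendallTau (placed c) (placed 0) d₀ → ∀ i →
      KendallTau (trajectory σ stay i) (placed 0) (d d₀ i)
    kendall k₀ zero    = k₀
    kendall k₀ (suc i) = done (λ _ → refl) , λ _ _ → z≤n

  ¬¬-opt : ¬ ¬ ∃ λ o → o ≤ c × IsOpt σ o
  ¬¬-opt none = ¬¬-stay-cost λ (e , e≤c , cost) →
    ¬¬-minimum (stay , stay-feasible , cost) λ (o , opt) →
    none (o , ≤-trans (proj₂ opt e (stay , stay-feasible , cost)) e≤c , opt)

  ¬¬-cost : ∀ (s : Solution σ) → ¬ ¬ ∃ (HasCost σ s)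
  ¬¬-cost s none = ¬¬-finite-choice
    (λ i → ¬¬-minimum (proj₂ (swaps-connected (trajectory σ s (inject₁ i)) (trajectory σ s (suc i)))))
    λ kd → none (_ , proj₁ ∘ kd , proj₂ ∘ kd , refl)

-- The competitive ratio

γ : ℚ
γ = ℤ.+ 1 ℚ./ 32

-- Unnormalised rationals keep the denominator 32 of the product literally, so that the inequality
-- can be read off as one between integers.
fromℕ-scaled : ∀ {a n o} → fromℕ a ℚ.≤ γ ℚ.* fromℕ n ℚ.* fromℕ o → a * 32 ≤ n * o
fromℕ-scaled {a} {n} {o} h = ℤ.drop‿+≤+ (subst₂ ℤ._≤_ left right (ℚᵘ.drop-*≤* unnormalised))
  where
  ι : ℕ → ℚᵘ.ℚᵘ
  ι m = mkℚᵘ (ℤ.+ m) 0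
  ι≃ : ∀ m → ℚ.toℚᵘ (fromℕ m) ℚᵘ.≃ ι m
  ι≃ m = ℚ.toℚᵘ-fromℚᵘ (ι m)
  unnormalised : ι a ℚᵘ.≤ mkℚᵘ (ℤ.+ 1) 31 ℚᵘ.* ι n ℚᵘ.* ι o
  unnormalised = begin
    ι a ≃⟨ ι≃ a ⟨
    ℚ.toℚᵘ (fromℕ a) ≤⟨ ℚ.toℚᵘ-mono-≤ h ⟩
    ℚ.toℚᵘ (γ ℚ.* fromℕ n ℚ.* fromℕ o) ≃⟨ ℚ.toℚᵘ-homo-* (γ ℚ.* fromℕ n) (fromℕ o) ⟩
    ℚ.toℚᵘ (γ ℚ.* fromℕ n) ℚᵘ.* ℚ.toℚᵘ (fromℕ o) ≃⟨ ℚᵘ.*-cong (ℚ.toℚᵘ-homo-* γ (fromℕ n)) (ι≃ o) ⟩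
    ℚ.toℚᵘ γ ℚᵘ.* ℚ.toℚᵘ (fromℕ n) ℚᵘ.* ι o ≃⟨ ℚᵘ.*-congʳ {ι o} (ℚᵘ.*-congˡ {ℚ.toℚᵘ γ} (ι≃ n)) ⟩
    mkℚᵘ (ℤ.+ 1) 31 ℚᵘ.* ι n ℚᵘ.* ι o ∎
    where open ℚᵘ.≤-Reasoning
  left : ℤ.+ a ℤ.* ℤ.+ 32 ≡ ℤ.+ (a * 32)
  left = sym (ℤ.pos-* a 32)
  right : ℤ.+ 1 ℤ.* ℤ.+ n ℤ.* ℤ.+ o ℤ.* ℤ.+ 1 ≡ ℤ.+ (n * o)
  right = begin
    ℤ.+ 1 ℤ.* ℤ.+ n ℤ.* ℤ.+ o ℤ.* ℤ.+ 1 ≡⟨ ℤ.*-identityʳ _ ⟩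
    ℤ.+ 1 ℤ.* ℤ.+ n ℤ.* ℤ.+ o         ≡⟨ cong (ℤ._* ℤ.+ o) (ℤ.*-identityˡ (ℤ.+ n)) ⟩
    ℤ.+ n ℤ.* ℤ.+ o                 ≡⟨ ℤ.pos-* n o ⟨
    ℤ.+ (n * o)                   ∎
    where open ≡-Reasoning

-- Origin of 32: with a single block, `s = 0`, the bounds are `a` at least 1, `o` at most 3 and `n`
-- at most 10, so the factor has to exceed 30. The first block is the worst case, since the bound on
-- `a` grows like `2 * S * S` and that on `n * o` like `8 * S * S`, where `S = suc s`. The term
-- `suc s * 2 * 32` on both sides replaces a subtraction.
ratio : ∀ s {r a o} → r ≤ 3 → suc s * 1 + suc s * suc s * 2 ≤ a + suc s * 2 → o ≤ 1 + suc s * 2 →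
  ¬ a * 32 ≤ (7 + (r + s * 4)) * o
ratio s {r} {a} {o} r≤3 a-large o-small h = <⇒≱ exceeded (begin
  (suc s * 1 + suc s * suc s * 2) * 32   ≤⟨ *-monoˡ-≤ 32 a-large ⟩
  (a + suc s * 2) * 32                   ≡⟨ *-distribʳ-+ 32 a (suc s * 2) ⟩
  a * 32 + suc s * 2 * 32                ≤⟨ +-monoˡ-≤ _ h ⟩
  (7 + (r + s * 4)) * o + suc s * 2 * 32 ≤⟨ +-monoˡ-≤ _ (*-mono-≤ (+-monoʳ-≤ 7 (+-monoˡ-≤ (s * 4) r≤3)) o-small) ⟩
  (7 + (3 + s * 4)) * (1 + suc s * 2) + suc s * 2 * 32 ∎)
  where
  open ≤-Reasoning
  difference : ∀ s → (suc s * 1 + suc s * suc s * 2) * 32 ≡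
    suc ((7 + (3 + s * 4)) * (1 + suc s * 2) + suc s * 2 * 32) + (1 + s * 64 + s * s * 56)
  difference = solve-∀
  exceeded : (7 + (3 + s * 4)) * (1 + suc s * 2) + suc s * 2 * 32 < (suc s * 1 + suc s * suc s * 2) * 32
  exceeded = ≤-trans (m≤m+n _ _) (≤-reflexive (sym (difference s)))

theorem16 : (K : Class) →
    ∃[ γ ] ∃[ n₀ ]
    (0ℚ ℚ.< γ ×
    (∀ n → n₀ ≤ n → (A : Algorithm n) → StaysClosestToStart K A →
    (c : ℚ) → Competitive K c A → γ ℚ.* fromℕ n ℚ.≤ c))
theorem16 K = γ , 7 , ℚ.positive⁻¹ γ , λ n 7≤n A closest c competitive →
  let q , 7+q≡n = m≤n⇒∃[o]m+o≡n 7≤n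
      n≡ = trans (sym 7+q≡n) (cong (λ q → 7 + q) (m≡m%n+[m/n]*n q 4))
  in bound n (q % 4) (q / 4) n≡ (s≤s⁻¹ (m%n<n q 4)) A closest c competitive
  where
  bound : ∀ n r s → n ≡ 7 + (r + s * 4) → r ≤ 3 → (A : Algorithm n) → StaysClosestToStart K A →
    (c : ℚ) → Competitive K c A → γ ℚ.* fromℕ n ℚ.≤ c
  bound n r s refl r≤3 A closest c competitive = decidable-stable (_ ℚ.≤? _) λ c-small →
    ¬¬-cost (run A σ) λ (a , cost) →
    ¬¬-opt λ (o , o≤ , opt) →
    ratio s {r} {a} {o} r≤3 (alg-cost A closest cost) o≤ (fromℕ-scaled {a} {n} {o} (ℚ.≤-trans (competitive σ a o cost opt)
      (ℚ.*-monoʳ-≤-nonNeg (fromℕ o) {{ℚ.normalize-nonNeg o 1}} (ℚ.<⇒≤ (ℚ.≰⇒> c-small)))))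
    where
    -- `fits` asks for `3 + S * 4` nodes, which is `7 + s * 4` for `S = suc s`. The lower bound on
    -- the cost is positive only with at least one block, hence the threshold 7.
    open Adversary K (suc s) (6 + (r + s * 4)) (s≤s (s≤s (s≤s (s≤s (s≤s (s≤s (m≤n+m (s * 4) r)))))))
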